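{- For integers $k>1$ let $G_k=P_{(2k+2)^2}\times P_{(2k+1)^2}$. Then $\dim_{k,f}(G_k)=\Theta(k^2)$ as $k\to\infty$; consequently both ratios $\frac{\dim_{1,f}(G_k)}{\dim_{k,f}(G_k)}$ and $\frac{\dim_{k,f}(G_k)}{\dim_f(G_k)}$ are unbounded as $k\to\infty$.
   Context: $P_s\times P_t$ denotes the grid graph, the Cartesian product of the paths on $s$ and $t$ vertices. $d(x,y)$ denotes the distance. For $g$ defined on $V(G)$ and $U\subseteq V(G)$, $g(U)=\sum_{s\in U}g(s)$. For distinct $x,y$, $R\{x,y\}=\{z: d(x,z)\ne d(y,z)\}$; $g:V(G)\to[0,1]$ is a resolving function if $g(R\{x,y\})\ge1$ for all distinct $x,y$, and $\dim_f(G)$ is the minimum of $g(V(G))$ over resolving functions. For a positive integer $k$, $d_k(x,y)=\min\{d(x,y),k+1\}$, $R_k\{x,y\}=\{z: d_k(x,z)\neq d_k(y,z)\}$; $h:V(G)\to[0,1]$ is a $k$-truncated resolving function if $h(R_k\{x,y\})\ge 1$ for all distinct $x,y$; $\dim_{k,f}(G)$ is the minimum of $h(V(G))$ over such $h$. $f=\Theta(g)$ means there are positive constants $c_1,c_2$ with $c_1 g\le f\le c_2 g$ for all sufficiently large arguments.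
   Formalization: Resolving functions take rational values in [0,1] instead of real ones, and the minima are taken over these; rounding a real resolving function up to rational values shows the minima agree. -}

module Defs where

open import Data.Nat as ℕ using (ℕ; zero; suc; _⊔_; _⊓_; _∸_)
open import Data.Fin using (Fin; toℕ)
import Data.Fin as Fin
open import Data.Product using (_×_; _,_; Σ)
open import Data.Integer using (+_)
open import Data.Rational using (ℚ; 0ℚ; 1ℚ; _+_; _/_; _≤_)
open import Relation.Binary.PropositionalEquality using (_≡_; _≢_)
open import Relation.Nullary using (yes; no; ¬_)

ℕ→ℚ : ℕ → ℚ
ℕ→ℚ n = (+ n) / 1

∣_-_∣ : ℕ → ℕ → ℕ
∣ a - b ∣ = (a ∸ b) ℕ.+ (b ∸ a)

Vtx : ℕ → ℕ → Set
Vtx s t = Fin s × Fin t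

-- Shortest-path distance in the grid graph P_s × P_t
-- (the Cartesian product of paths): the Manhattan distance.
gridDist : ∀ {s t} → Vtx s t → Vtx s t → ℕ
gridDist (i , j) (i' , j') = ∣ toℕ i - toℕ i' ∣ ℕ.+ ∣ toℕ j - toℕ j' ∣

truncDist : ∀ {s t} → ℕ → Vtx s t → Vtx s t → ℕ
truncDist k x y = gridDist x y ⊓ suc k

sumFin : (n : ℕ) → (Fin n → ℚ) → ℚ
sumFin zero f = 0ℚ
sumFin (suc n) f = f Fin.zero + sumFin n (λ i → f (Fin.suc i))

sumV : ∀ s t → (Vtx s t → ℚ) → ℚ
sumV s t g = sumFin s (λ i → sumFin t (λ j → g (i , j)))

weightResolving : ∀ s t → (Vtx s t → Vtx s t → ℕ) → (Vtx s t → ℚ)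
                → Vtx s t → Vtx s t → ℚ
weightResolving s t δ g x y =
  sumV s t (λ z → sel (δ x z ℕ.≟ δ y z) (g z))
  where
    open import Relation.Nullary using (Dec)
    sel : ∀ {P : Set} → Dec P → ℚ → ℚ
    sel (yes _) q = 0ℚ
    sel (no _)  q = q

IsResolvingFn : ∀ s t → (Vtx s t → Vtx s t → ℕ) → (Vtx s t → ℚ) → Set
IsResolvingFn s t δ g =
  (∀ z → (0ℚ ≤ g z) × (g z ≤ 1ℚ)) ×
  (∀ x y → x ≢ y → 1ℚ ≤ weightResolving s t δ g x y)

IsMinWeight : ∀ s t → (Vtx s t → Vtx s t → ℕ) → ℚ → Set
IsMinWeight s t δ r =
  Σ (Vtx s t → ℚ) (λ g → IsResolvingFn s t δ g × (sumV s t g ≡ r)) ×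
  (∀ g → IsResolvingFn s t δ g → r ≤ sumV s t g)

IsFracDim : ℕ → ℕ → ℚ → Set
IsFracDim s t r = IsMinWeight s t gridDist r

IsTruncFracDim : ℕ → ℕ → ℕ → ℚ → Set
IsTruncFracDim k s t r = IsMinWeight s t (truncDist k) r

sG : ℕ → ℕ
sG k = (2 ℕ.* k ℕ.+ 2) ℕ.* (2 ℕ.* k ℕ.+ 2)

tG : ℕ → ℕ
tG k = (2 ℕ.* k ℕ.+ 1) ℕ.* (2 ℕ.* k ℕ.+ 1)

{-# OPTIONS --safe #-}

-- Lower bounds: if x, y are the two central vertices of a (2k+2) × (2k+1) tile, every vertex outside the tile is at
-- distance more than k from both, so R_k{x,y} lies in the tile and each tile carries weight at least 1.  G_k splits
-- into (2k+2)(2k+1) such tiles, and for k ≡ 1 mod 3 also into order k⁴ tiles of size 4 × 3.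
-- Upper bounds: put weight 1 on a lattice with spacing q.  Three corners of the lattice cell of a vertex x, all within
-- distance 2q, determine x among all vertices; with 2q ≤ k this takes O(k²) lattice points.  Without truncation the
-- corners of the grid suffice, so dim_f ≤ 4.
-- That the minima exist, and are rational, is linear programming over ℚ, done by Fourier–Motzkin elimination.
module Submission where

open import Defs
open import Data.Nat as ℕ using (ℕ; zero; suc; _<_; _≤_)
import Data.Nat.Properties as ℕ
open import Data.Nat.Coprimality using (1-coprimeTo) renaming (sym to coprime-sym)
open import Data.Nat.DivMod using (_/_; m/n*n≤m; m<n*o⇒m/o<n; m≡m%n+[m/n]*n; m%n<n; m≥n⇒m/n>0)
open import Data.Nat.Tactic.RingSolver using (solve-∀)
open import Data.Integer as ℤ using (-[1+_]) renaming (+_ to pos)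
import Data.Integer.Properties as ℤ
open import Data.Rational
  using (ℚ; mkℚ; 0ℚ; 1ℚ; _+_; _*_; -_; _-_; 1/_; _⊔_; toℚᵘ; *≤*; *<*; NonZero; Positive; Negative;
         positive; negative; nonNegative)
  renaming (_≤_ to _≤ℚ_; _<_ to _<ℚ_)
open import Data.Rational.Properties as ℚ hiding (_≟_)
open import Data.Rational.Solver using (module +-*-Solver)
open import Data.Rational.Unnormalised as ℚᵘ using (mkℚᵘ; _≃_; *≡*)
import Data.Rational.Unnormalised.Properties as ℚᵘ
open import Data.Fin as Fin using (Fin; zero; suc; toℕ; fromℕ; fromℕ<; inject₁; _↑ˡ_; _↑ʳ_; combine; remQuot)
import Data.Fin.Properties as Fin
open import Data.Vec.Functional as Vector using (Vector)
open import Data.List using (List; []; _∷_; _++_; map; foldr; filter; allFin; cartesianProduct; cartesianProductWith)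
open import Data.List.Membership.Propositional using (_∈_)
open import Data.List.Membership.Propositional.Properties
  using (∈-allFin; ∈-filter⁺; ∈-filter⁻; ∈-cartesianProduct⁺; ∈-cartesianProductWith⁺; ∈-cartesianProductWith⁻)
open import Data.List.Relation.Unary.All as All using (All; []; _∷_)
import Data.List.Relation.Unary.All.Properties as All
open import Data.List.Relation.Unary.Any using (here; there)
open import Data.Bool using (if_then_else_)
open import Data.Product using (_×_; _,_; Σ; ∃-syntax; proj₁; proj₂; uncurry)
open import Function using (_∘_; id; _⇔_; mk⇔; Equivalence)
open import Function.Properties.Equivalence using () renaming (trans to ⇔-trans)
open import Relation.Binary.Definitions using (tri<; tri≈; tri>)
open import Relation.Binary.PropositionalEquality
open import Relation.Nullary using (Dec; yes; no; does; contradiction; ¬?; ¬_)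
open import Algebra.Bundles using (CommutativeRing)
open import Algebra.Properties.Semiring.Sum (CommutativeRing.semiring ℚ.+-*-commutativeRing)

-- Every dimension in the statement must be attained at a rational `r`, and ℚ offers no compactness
-- argument, so estimates alone do not suffice: the minimiser itself has to come out of finitely
-- many linear inequalities. The bounds have the same order because `G_k` has about 16k⁴ vertices, a
-- tile has about 4k², and a lattice of spacing about k/2 has one point per order k² vertices. A
-- tile has one row more than it has columns because its two centres lie in adjacent rows and in the
-- same column. For the tiles of size 4 × 3, 4 always divides (2k+2)², but 3 divides (2k+1)² only if
-- k ≡ 1 mod 3. This subsequence is enough, since unboundedness asks for one k for each bound. Along
-- it both ratios are at least of order k².

-- Order and finite sums in ℚ.

0≤q-p⇔p≤q : ∀ {p q} → 0ℚ ≤ℚ q - p ⇔ p ≤ℚ q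
0≤q-p⇔p≤q {p} {q} = mk⇔ to from
  where
  q-p+p≡q : (q - p) + p ≡ q
  q-p+p≡q = solve 2 (λ q p → (q :- p) :+ p := q) refl q p
    where open +-*-Solver
  to : 0ℚ ≤ℚ q - p → p ≤ℚ q
  to 0≤ = subst₂ _≤ℚ_ (+-identityˡ p) q-p+p≡q (+-monoˡ-≤ p 0≤)
  from : p ≤ℚ q → 0ℚ ≤ℚ q - p
  from p≤q = subst (_≤ℚ q - p) (+-inverseʳ p) (+-monoˡ-≤ (- p) p≤q)

indicator : ∀ {P : Set} → Dec P → ℚ
indicator d = if does d then 1ℚ else 0ℚ

indicator-nonneg : ∀ {P : Set} (d : Dec P) → 0ℚ ≤ℚ indicator d
indicator-nonneg (yes _) = ≤ᵇ⇒≤ _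
indicator-nonneg (no _)  = ≤-refl

indicator≤1 : ∀ {P : Set} (d : Dec P) → indicator d ≤ℚ 1ℚ
indicator≤1 (yes _) = ≤-refl
indicator≤1 (no _)  = ≤ᵇ⇒≤ _

sum-mono : ∀ {n} {f g : Vector ℚ n} → (∀ i → f i ≤ℚ g i) → sum f ≤ℚ sum g
sum-mono {zero}  f≤g = ≤-refl
sum-mono {suc n} f≤g = +-mono-≤ (f≤g zero) (sum-mono (f≤g ∘ suc))

sum-zero : ∀ {n} {f : Vector ℚ n} → (∀ i → f i ≡ 0ℚ) → sum f ≡ 0ℚ
sum-zero {n} f≡0 = trans (sum-cong-≗ f≡0) (sum-replicate-zero n)

sum-concentrated : ∀ {n} (f : Vector ℚ n) k → (∀ i → i ≢ k → f i ≡ 0ℚ) → sum f ≡ f k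
sum-concentrated f zero    off = trans (cong (f zero +_) (sum-zero λ i → off (suc i) λ ())) (+-identityʳ _)
sum-concentrated f (suc k) off =
  trans (cong₂ _+_ (off zero λ ()) (sum-concentrated (f ∘ suc) k λ i i≢k → off (suc i) (i≢k ∘ Fin.suc-injective)))
        (+-identityˡ _)

sum-indicator : ∀ {n} (k : Fin n) (f : Vector ℚ n) → ∑[ i < n ] (indicator (k Fin.≟ i) * f i) ≡ f k
sum-indicator k f = trans (sum-concentrated _ k off) on
  where
  off : ∀ i → i ≢ k → indicator (k Fin.≟ i) * f i ≡ 0ℚ
  off i i≢k with k Fin.≟ i
  ... | yes k≡i = contradiction (sym k≡i) i≢k
  ... | no _    = *-zeroˡ (f i)
  on : indicator (k Fin.≟ k) * f k ≡ f k
  on with k Fin.≟ k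
  ... | yes _   = *-identityˡ (f k)
  ... | no  k≢k = contradiction refl k≢k

-- Fourier–Motzkin elimination

Affine : ℕ → Set
Affine n = Vector ℚ n × ℚ

value : ∀ {n} → Affine n → Vector ℚ n → ℚ
value {n} (a , c) x = ∑[ i < n ] (a i * x i) + c

scale : ∀ {n} → ℚ → Affine n → Affine n
scale k (a , c) = (λ i → k * a i) , k * c

_⊖_ : ∀ {n} → Affine n → Affine n → Affine n
(a , c) ⊖ (b , d) = (λ i → a i - b i) , c - d

value-scale : ∀ {n} k (e : Affine n) x → value (scale k e) x ≡ k * value e x
value-scale k (a , c) x = begin
  sum (λ i → k * a i * x i) + k * c        ≡⟨ cong (_+ k * c) (sum-cong-≗ λ i → *-assoc k (a i) (x i)) ⟩
  sum (λ i → k * (a i * x i)) + k * c      ≡⟨ cong (_+ k * c) (*-distribˡ-sum k (λ i → a i * x i)) ⟨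
  k * sum (λ i → a i * x i) + k * c        ≡⟨ *-distribˡ-+ k _ c ⟨
  k * (sum (λ i → a i * x i) + c)          ∎
  where open ≡-Reasoning

value-⊖ : ∀ {n} (e f : Affine n) x → value (e ⊖ f) x ≡ value e x - value f x
value-⊖ {zero} (a , c) (b , d) x =
  solve 2 (λ c d → con 0ℚ :+ (c :- d) := (con 0ℚ :+ c) :- (con 0ℚ :+ d)) refl c d
  where open +-*-Solver
value-⊖ {suc n} (a , c) (b , d) x = begin
  (a zero - b zero) * x zero + tail-sum + (c - d)
    ≡⟨ +-assoc ((a zero - b zero) * x zero) tail-sum (c - d) ⟩
  (a zero - b zero) * x zero + (tail-sum + (c - d))
    ≡⟨ cong ((a zero - b zero) * x zero +_) (value-⊖ (a ∘ suc , c) (b ∘ suc , d) (x ∘ suc)) ⟩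
  (a zero - b zero) * x zero + ((A + c) - (B + d))
    ≡⟨ solve 7 (λ a b x A B c d → (a :- b) :* x :+ ((A :+ c) :- (B :+ d)) := (a :* x :+ A :+ c) :- (b :* x :+ B :+ d))
         refl (a zero) (b zero) (x zero) A B c d ⟩
  (a zero * x zero + A + c) - (b zero * x zero + B + d) ∎
  where
  open ≡-Reasoning
  open +-*-Solver
  tail-sum = ∑[ i < n ] ((a (suc i) - b (suc i)) * x (suc i))
  A = ∑[ i < n ] (a (suc i) * x (suc i))
  B = ∑[ i < n ] (b (suc i) * x (suc i))

Sat : ∀ {n} → List (Affine n) → Vector ℚ n → Set
Sat L x = All (λ e → 0ℚ ≤ℚ value e x) L

-- Points are functions, and pointwise equality does not give `≡` between them, so satisfaction has
-- to be transported explicitly.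
Sat-cong : ∀ {n} {L : List (Affine n)} {x y} → (∀ i → x i ≡ y i) → Sat L x → Sat L y
Sat-cong x≗y = All.map λ { {a , c} → subst (λ s → 0ℚ ≤ℚ s + c) (sum-cong-≗ λ i → cong (a i *_) (x≗y i)) }

data Solved {n} (e : Affine (suc n)) : Set where
  lower : (l : Affine n) → (∀ x → 0ℚ ≤ℚ value e x ⇔ value l (x ∘ suc) ≤ℚ x zero) → Solved e
  upper : (u : Affine n) → (∀ x → 0ℚ ≤ℚ value e x ⇔ x zero ≤ℚ value u (x ∘ suc)) → Solved e
  free  : (f : Affine n) → (∀ x → 0ℚ ≤ℚ value e x ⇔ 0ℚ ≤ℚ value f (x ∘ suc)) → Solved e

-- Factoring out the leading coefficient leaves only its sign to decide whether the constraint
-- bounds `x zero` from below or from above.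
value-factor : ∀ {n} (a : Vector ℚ (suc n)) c x .{{_ : NonZero (a zero)}} →
  value (a , c) x ≡ a zero * (x zero - value (scale (- 1/ a zero) (a ∘ suc , c)) (x ∘ suc))
value-factor {n} a c x = begin
  a₀ * x zero + A + c                             ≡⟨ solve 4 (λ a x A c → a :* x :+ A :+ c := a :* x :+ con 1ℚ :* (A :+ c)) refl a₀ (x zero) A c ⟩
  a₀ * x zero + 1ℚ * v                            ≡⟨ cong (λ u → a₀ * x zero + u * v) (*-inverseʳ a₀) ⟨
  a₀ * x zero + a₀ * 1/ a₀ * v                    ≡⟨ solve 4 (λ a x r v → a :* x :+ a :* r :* v := a :* (x :- (:- r) :* v)) refl a₀ (x zero) (1/ a₀) v ⟩
  a₀ * (x zero - (- 1/ a₀) * v)                   ≡⟨ cong (λ w → a₀ * (x zero - w)) (value-scale (- 1/ a₀) (a ∘ suc , c) (x ∘ suc)) ⟨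
  a₀ * (x zero - value (scale (- 1/ a₀) (a ∘ suc , c)) (x ∘ suc)) ∎
  where
  open ≡-Reasoning
  open +-*-Solver
  a₀ = a zero
  A  = ∑[ i < n ] (a (suc i) * x (suc i))
  v  = A + c

0≤p*q⇔0≤q : ∀ p q .{{_ : Positive p}} → 0ℚ ≤ℚ p * q ⇔ 0ℚ ≤ℚ q
0≤p*q⇔0≤q p q = mk⇔
  (λ h → *-cancelˡ-≤-pos p (subst (_≤ℚ p * q) (sym (*-zeroʳ p)) h))
  (λ h → subst (_≤ℚ p * q) (*-zeroʳ p) (*-monoˡ-≤-nonNeg p {{pos⇒nonNeg p}} h))

0≤p*q⇔q≤0 : ∀ p q .{{_ : Negative p}} → 0ℚ ≤ℚ p * q ⇔ q ≤ℚ 0ℚ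
0≤p*q⇔q≤0 p q = mk⇔
  (λ h → *-cancelˡ-≤-neg p (subst (_≤ℚ p * q) (sym (*-zeroʳ p)) h))
  (λ h → subst (_≤ℚ p * q) (*-zeroʳ p) (*-monoˡ-≤-nonPos p {{neg⇒nonPos p}} h))

q-p≤0⇔q≤p : ∀ {p q} → q - p ≤ℚ 0ℚ ⇔ q ≤ℚ p
q-p≤0⇔q≤p {p} {q} = mk⇔ to from
  where
  q-p+p≡q : (q - p) + p ≡ q
  q-p+p≡q = solve 2 (λ q p → (q :- p) :+ p := q) refl q p
    where open +-*-Solver
  to : q - p ≤ℚ 0ℚ → q ≤ℚ p
  to ≤0 = subst₂ _≤ℚ_ q-p+p≡q (+-identityˡ p) (+-monoˡ-≤ p ≤0)
  from : q ≤ℚ p → q - p ≤ℚ 0ℚ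
  from q≤p = subst (q - p ≤ℚ_) (+-inverseʳ p) (+-monoˡ-≤ (- p) q≤p)

≡⇒0≤⇔ : ∀ {p q} → p ≡ q → 0ℚ ≤ℚ p ⇔ 0ℚ ≤ℚ q
≡⇒0≤⇔ p≡q = mk⇔ (subst (0ℚ ≤ℚ_) p≡q) (subst (0ℚ ≤ℚ_) (sym p≡q))

solveFirst : ∀ {n} (e : Affine (suc n)) → Solved e
solveFirst {n} (a , c) with <-cmp (a zero) 0ℚ
... | tri< a₀<0 _ _ = upper (scale (- 1/ a zero) (a ∘ suc , c)) λ x →
  ⇔-trans (≡⇒0≤⇔ (value-factor a c x)) (⇔-trans (0≤p*q⇔q≤0 (a zero) _) q-p≤0⇔q≤p)
  where instance
    _ = negative a₀<0
    _ = neg⇒nonZero (a zero)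
... | tri> _ _ a₀>0 = lower (scale (- 1/ a zero) (a ∘ suc , c)) λ x →
  ⇔-trans (≡⇒0≤⇔ (value-factor a c x)) (⇔-trans (0≤p*q⇔0≤q (a zero) _) 0≤q-p⇔p≤q)
  where instance
    _ = positive a₀>0
    _ = pos⇒nonZero (a zero)
... | tri≈ _ a₀≡0 _ = free (a ∘ suc , c) λ x → ≡⇒0≤⇔ (cong (_+ c) (first-vanishes x))
  where
  first-vanishes : ∀ x → ∑[ i < suc n ] (a i * x i) ≡ ∑[ i < n ] (a (suc i) * x (suc i))
  first-vanishes x = trans (cong (_+ A) (trans (cong (_* x zero) a₀≡0) (*-zeroˡ (x zero)))) (+-identityˡ A)
    where A = ∑[ i < n ] (a (suc i) * x (suc i))

record Bounds (n : ℕ) : Set where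
  field
    lowers uppers frees : List (Affine n)

  Holds : Vector ℚ (suc n) → Set
  Holds x = All (λ l → value l (x ∘ suc) ≤ℚ x zero) lowers
          × All (λ u → x zero ≤ℚ value u (x ∘ suc)) uppers
          × All (λ f → 0ℚ ≤ℚ value f (x ∘ suc)) frees

open Bounds

bounds : ∀ {n} (L : List (Affine (suc n))) → Σ (Bounds n) λ B → ∀ x → Sat L x ⇔ Holds B x
bounds [] = record { lowers = [] ; uppers = [] ; frees = [] } , λ x → mk⇔ (λ _ → [] , [] , []) (λ _ → [])
bounds (e ∷ L) with bounds L | solveFirst e
... | B , L⇔B | lower l e⇔l = record B { lowers = l ∷ lowers B } , λ x → mk⇔
  (λ { (p ∷ ps) → let ls , us , fs = Equivalence.to (L⇔B x) ps in Equivalence.to (e⇔l x) p ∷ ls , us , fs })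
  (λ { (q ∷ ls , us , fs) → Equivalence.from (e⇔l x) q ∷ Equivalence.from (L⇔B x) (ls , us , fs) })
... | B , L⇔B | upper u e⇔u = record B { uppers = u ∷ uppers B } , λ x → mk⇔
  (λ { (p ∷ ps) → let ls , us , fs = Equivalence.to (L⇔B x) ps in ls , Equivalence.to (e⇔u x) p ∷ us , fs })
  (λ { (ls , q ∷ us , fs) → Equivalence.from (e⇔u x) q ∷ Equivalence.from (L⇔B x) (ls , us , fs) })
... | B , L⇔B | free f e⇔f = record B { frees = f ∷ frees B } , λ x → mk⇔
  (λ { (p ∷ ps) → let ls , us , fs = Equivalence.to (L⇔B x) ps in ls , us , Equivalence.to (e⇔f x) p ∷ fs })
  (λ { (ls , us , q ∷ fs) → Equivalence.from (e⇔f x) q ∷ Equivalence.from (L⇔B x) (ls , us , fs) })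

-- The fold starts at 0 because the eliminated variable is nonnegative.
maximum : ∀ {n} → List (Affine n) → Vector ℚ n → ℚ
maximum L y = foldr (λ l m → value l y ⊔ m) 0ℚ L

maximum-nonneg : ∀ {n} (L : List (Affine n)) y → 0ℚ ≤ℚ maximum L y
maximum-nonneg []      y = ≤-refl
maximum-nonneg (l ∷ L) y = ≤-trans (maximum-nonneg L y) (p≤q⊔p (value l y) (maximum L y))

≤maximum : ∀ {n} (L : List (Affine n)) y → All (λ l → value l y ≤ℚ maximum L y) L
≤maximum []      y = []
≤maximum (l ∷ L) y = p≤p⊔q (value l y) (maximum L y)
  ∷ All.map (λ h → ≤-trans h (p≤q⊔p (value l y) (maximum L y))) (≤maximum L y)

maximum-least : ∀ {n} {L : List (Affine n)} {y b} → 0ℚ ≤ℚ b → All (λ l → value l y ≤ℚ b) L → maximum L y ≤ℚ b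
maximum-least 0≤b []       = 0≤b
maximum-least 0≤b (h ∷ hs) = ⊔-lub h (maximum-least 0≤b hs)

zeroAffine : ∀ {n} → Affine n
zeroAffine = (λ _ → 0ℚ) , 0ℚ

value-zeroAffine : ∀ {n} (x : Vector ℚ n) → value zeroAffine x ≡ 0ℚ
value-zeroAffine x = trans (+-identityʳ _) (sum-zero λ i → *-zeroˡ (x i))

-- If every lower bound is at most every upper bound, the largest lower bound satisfies them all and
-- is the least possible choice of the variable. This least choice becomes the optimum once only the
-- objective variable is left.
eliminate : ∀ {n} (L : List (Affine (suc n))) → Σ (List (Affine n)) λ L' →
  (∀ x → 0ℚ ≤ℚ x zero → Sat L x → Sat L' (x ∘ suc)) ×
  (∀ y → Sat L' y → ∃[ x₀ ] (0ℚ ≤ℚ x₀ × Sat L (x₀ Vector.∷ y)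
                             × (∀ x₁ → 0ℚ ≤ℚ x₁ → Sat L (x₁ Vector.∷ y) → x₀ ≤ℚ x₁)))
eliminate {n} L with bounds L
... | B , L⇔B = frees B ++ differences , sound , complete
  where
  -- The sign condition on the eliminated variable enters as one more lower bound, so each upper
  -- bound is also compared with 0.
  lowers₀ = zeroAffine ∷ lowers B
  differences = cartesianProductWith _⊖_ (uppers B) lowers₀

  difference⇔ : ∀ u l y → 0ℚ ≤ℚ value (u ⊖ l) y ⇔ value l y ≤ℚ value u y
  difference⇔ u l y = ⇔-trans (≡⇒0≤⇔ (value-⊖ u l y)) 0≤q-p⇔p≤q

  sound : ∀ x → 0ℚ ≤ℚ x zero → Sat L x → Sat (frees B ++ differences) (x ∘ suc)
  sound x 0≤x₀ sat with Equivalence.to (L⇔B x) sat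
  ... | ls , us , fs = All.++⁺ fs (All.tabulate diff)
    where
    ls₀ : All (λ l → value l (x ∘ suc) ≤ℚ x zero) lowers₀
    ls₀ = subst (_≤ℚ x zero) (sym (value-zeroAffine (x ∘ suc))) 0≤x₀ ∷ ls
    diff : ∀ {e} → e ∈ differences → 0ℚ ≤ℚ value e (x ∘ suc)
    diff e∈ with ∈-cartesianProductWith⁻ _⊖_ (uppers B) lowers₀ e∈
    ... | u , l , u∈ , l∈ , refl =
      Equivalence.from (difference⇔ u l (x ∘ suc)) (≤-trans (All.lookup ls₀ l∈) (All.lookup us u∈))

  complete : ∀ y → Sat (frees B ++ differences) y → _
  complete y sat = x₀ , maximum-nonneg (lowers B) y
    , Equivalence.from (L⇔B (x₀ Vector.∷ y)) (≤maximum (lowers B) y , All.tabulate x₀≤ , All.++⁻ˡ (frees B) sat)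
    , λ x₁ 0≤x₁ sat₁ → maximum-least 0≤x₁ (proj₁ (Equivalence.to (L⇔B (x₁ Vector.∷ y)) sat₁))
    where
    x₀ = maximum (lowers B) y
    ≤upper : ∀ {u l} → u ∈ uppers B → l ∈ lowers₀ → value l y ≤ℚ value u y
    ≤upper {u} {l} u∈ l∈ = Equivalence.to (difference⇔ u l y)
      (All.lookup (All.++⁻ʳ (frees B) sat) (∈-cartesianProductWith⁺ _⊖_ u∈ l∈))
    x₀≤ : ∀ {u} → u ∈ uppers B → x₀ ≤ℚ value u y
    x₀≤ {u} u∈ = maximum-least {L = lowers B}
      (subst (_≤ℚ value u y) (value-zeroAffine y) (≤upper u∈ (here refl)))
      (All.tabulate λ l∈ → ≤upper u∈ (there l∈))

-- Minimising the last coordinate over a linear system.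

Nonneg : ∀ {n} → Vector ℚ n → Set
Nonneg x = ∀ i → 0ℚ ≤ℚ x i

-- Elimination proceeds from the front, so the objective in the last place is the only variable that
-- survives to the base case. Its least value is found there, and back-substitution extends it
-- without changing it. The given point `x` shows that each projected system is satisfiable.
minimiseLast : ∀ n (L : List (Affine (suc n))) x → Nonneg x → Sat L x →
  ∃[ z ] (Nonneg z × Sat L z × (∀ w → Nonneg w → Sat L w → z (fromℕ n) ≤ℚ w (fromℕ n)))
minimiseLast zero L x 0≤x sat =
  let L' , sound , complete    = eliminate L
      z₀ , 0≤z₀ , sat₀ , least = complete (x ∘ suc) (sound x (0≤x zero) sat)
  in (z₀ Vector.∷ x ∘ suc) , (λ { zero → 0≤z₀ }) , sat₀
   -- Both tails have index set `Fin 0`, so they agree pointwise.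
   , λ w 0≤w satw → least (w zero) (0≤w zero) (Sat-cong {x = w} {y = w zero Vector.∷ x ∘ suc} (λ { zero → refl }) satw)
minimiseLast (suc n) L x 0≤x sat =
  let L' , sound , complete    = eliminate L
      z , 0≤z , satz , least   = minimiseLast n L' (x ∘ suc) (0≤x ∘ suc) (sound x (0≤x zero) sat)
      z₀ , 0≤z₀ , sat₀ , _     = complete z satz
  in (z₀ Vector.∷ z) , (λ { zero → 0≤z₀ ; (suc i) → 0≤z i }) , sat₀
   , λ w 0≤w satw → least (w ∘ suc) (0≤w ∘ suc) (sound w (0≤w zero) satw)

snoc : ∀ {n} → Vector ℚ n → ℚ → Vector ℚ (suc n)
snoc {zero}  x r = λ _ → r
snoc {suc n} x r = x zero Vector.∷ snoc (x ∘ suc) r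

snoc-fromℕ : ∀ {n} (x : Vector ℚ n) r → snoc x r (fromℕ n) ≡ r
snoc-fromℕ {zero}  x r = refl
snoc-fromℕ {suc n} x r = snoc-fromℕ (x ∘ suc) r

snoc-nonneg : ∀ {n} {x : Vector ℚ n} {r} → Nonneg x → 0ℚ ≤ℚ r → Nonneg (snoc x r)
snoc-nonneg {zero}  0≤x 0≤r _       = 0≤r
snoc-nonneg {suc n} 0≤x 0≤r zero    = 0≤x zero
snoc-nonneg {suc n} 0≤x 0≤r (suc i) = snoc-nonneg (0≤x ∘ suc) 0≤r i

snoc-inject₁ : ∀ {n} (x : Vector ℚ n) r i → snoc x r (inject₁ i) ≡ x i
snoc-inject₁ x r zero    = refl
snoc-inject₁ x r (suc i) = snoc-inject₁ (x ∘ suc) r i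

value-snoc : ∀ {n} (a : Vector ℚ n) b c z →
  value (snoc a b , c) z ≡ ∑[ i < n ] (a i * z (inject₁ i)) + (b * z (fromℕ n) + c)
value-snoc {zero} a b c z =
  solve 3 (λ b r c → (b :* r :+ con 0ℚ) :+ c := con 0ℚ :+ (b :* r :+ c)) refl b (z zero) c
  where open +-*-Solver
value-snoc {suc n} a b c z = begin
  a zero * z zero + S + c     ≡⟨ +-assoc (a zero * z zero) S c ⟩
  a zero * z zero + (S + c)   ≡⟨ cong (a zero * z zero +_) (value-snoc (a ∘ suc) b c (z ∘ suc)) ⟩
  a zero * z zero + (T + _)   ≡⟨ +-assoc (a zero * z zero) T _ ⟨
  a zero * z zero + T + _     ∎
  where
  open ≡-Reasoning
  S = ∑[ i < suc n ] (snoc (a ∘ suc) b i * z (suc i))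
  T = ∑[ i < n ] (a (suc i) * z (suc (inject₁ i)))

-- Fractional covering as a linear program.

Feasible : ∀ {n} → List (Vector ℚ n) → Vector ℚ n → Set
Feasible {n} A x = (∀ i → 0ℚ ≤ℚ x i × x i ≤ℚ 1ℚ) × All (λ a → 1ℚ ≤ℚ ∑[ i < n ] (a i * x i)) A

-- The last variable is an upper bound for the objective ∑ x.
coverProgram : ∀ {n} → List (Vector ℚ n) → List (Affine (suc n))
coverProgram {n} A = (snoc (λ _ → - 1ℚ) 1ℚ , 0ℚ)
  ∷ map (λ i → snoc (λ j → indicator (i Fin.≟ j) * - 1ℚ) 0ℚ , 1ℚ) (allFin n)
  ++ map (λ a → snoc a 0ℚ , - 1ℚ) A

module _ {n : ℕ} (z : Vector ℚ (suc n)) where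
  private
    x = z ∘ inject₁
    r = z (fromℕ n)

  objective⇔ : 0ℚ ≤ℚ value (snoc (λ _ → - 1ℚ) 1ℚ , 0ℚ) z ⇔ sum x ≤ℚ r
  objective⇔ = ⇔-trans (≡⇒0≤⇔ (begin
    value (snoc (λ _ → - 1ℚ) 1ℚ , 0ℚ) z                   ≡⟨ value-snoc (λ _ → - 1ℚ) 1ℚ 0ℚ z ⟩
    sum (λ i → - 1ℚ * x i) + (1ℚ * r + 0ℚ)                ≡⟨ cong (_+ (1ℚ * r + 0ℚ)) (*-distribˡ-sum (- 1ℚ) x) ⟨
    - 1ℚ * sum x + (1ℚ * r + 0ℚ)                          ≡⟨ solve 2 (λ s r → con (- 1ℚ) :* s :+ (con 1ℚ :* r :+ con 0ℚ) := r :- s) refl (sum x) r ⟩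
    r - sum x                                             ∎)) 0≤q-p⇔p≤q
    where
    open ≡-Reasoning
    open +-*-Solver

  cap⇔ : ∀ i → 0ℚ ≤ℚ value (snoc (λ j → indicator (i Fin.≟ j) * - 1ℚ) 0ℚ , 1ℚ) z ⇔ x i ≤ℚ 1ℚ
  cap⇔ i = ⇔-trans (≡⇒0≤⇔ (begin
    value (snoc (λ j → indicator (i Fin.≟ j) * - 1ℚ) 0ℚ , 1ℚ) z          ≡⟨ value-snoc (λ j → indicator (i Fin.≟ j) * - 1ℚ) 0ℚ 1ℚ z ⟩
    sum (λ j → indicator (i Fin.≟ j) * - 1ℚ * x j) + (0ℚ * r + 1ℚ)       ≡⟨ cong (_+ (0ℚ * r + 1ℚ)) (sum-cong-≗ λ j → *-assoc (indicator (i Fin.≟ j)) (- 1ℚ) (x j)) ⟩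
    sum (λ j → indicator (i Fin.≟ j) * (- 1ℚ * x j)) + (0ℚ * r + 1ℚ)     ≡⟨ cong (_+ (0ℚ * r + 1ℚ)) (sum-indicator i λ j → - 1ℚ * x j) ⟩
    - 1ℚ * x i + (0ℚ * r + 1ℚ)                                           ≡⟨ solve 2 (λ s r → con (- 1ℚ) :* s :+ (con 0ℚ :* r :+ con 1ℚ) := con 1ℚ :- s) refl (x i) r ⟩
    1ℚ - x i                                                             ∎)) 0≤q-p⇔p≤q
    where
    open ≡-Reasoning
    open +-*-Solver

  cover⇔ : ∀ a → 0ℚ ≤ℚ value (snoc a 0ℚ , - 1ℚ) z ⇔ 1ℚ ≤ℚ ∑[ i < n ] (a i * x i)
  cover⇔ a = ⇔-trans (≡⇒0≤⇔ (begin
    value (snoc a 0ℚ , - 1ℚ) z                        ≡⟨ value-snoc a 0ℚ (- 1ℚ) z ⟩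
    sum (λ i → a i * x i) + (0ℚ * r + - 1ℚ)           ≡⟨ solve 2 (λ s r → s :+ (con 0ℚ :* r :+ con (- 1ℚ)) := s :- con 1ℚ) refl (sum λ i → a i * x i) r ⟩
    sum (λ i → a i * x i) - 1ℚ                        ∎)) 0≤q-p⇔p≤q
    where
    open ≡-Reasoning
    open +-*-Solver

  coverProgram⇔ : ∀ A → Nonneg z → Sat (coverProgram A) z ⇔ (Feasible A x × sum x ≤ℚ r)
  coverProgram⇔ A 0≤z = mk⇔ to from
    where
    caps = map (λ i → snoc (λ j → indicator (i Fin.≟ j) * - 1ℚ) 0ℚ , 1ℚ) (allFin n)
    to : Sat (coverProgram A) z → Feasible A x × sum x ≤ℚ r
    to (obj ∷ rest) =
      ( (λ i → 0≤z (inject₁ i) , Equivalence.to (cap⇔ i) (All.lookup (All.map⁻ (All.++⁻ˡ caps rest)) (∈-allFin i)))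
      , All.map (λ {a} → Equivalence.to (cover⇔ a)) (All.map⁻ (All.++⁻ʳ caps rest)) )
      , Equivalence.to objective⇔ obj
    from : Feasible A x × sum x ≤ℚ r → Sat (coverProgram A) z
    from ((box , cov) , Σ≤r) = Equivalence.from objective⇔ Σ≤r
      ∷ All.++⁺ (All.map⁺ (All.universal (λ i → Equivalence.from (cap⇔ i) (proj₂ (box i))) (allFin n)))
                (All.map⁺ (All.map (λ {a} → Equivalence.from (cover⇔ a)) cov))

Feasible-cong : ∀ {n} {A : List (Vector ℚ n)} {x y : Vector ℚ n} → (∀ i → x i ≡ y i) → Feasible A x → Feasible A y
Feasible-cong x≗y (box , cov) =
  (λ i → subst (λ p → 0ℚ ≤ℚ p × p ≤ℚ 1ℚ) (x≗y i) (box i)) ,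
  All.map (λ {a} → subst (1ℚ ≤ℚ_) (sum-cong-≗ λ i → cong (a i *_) (x≗y i))) cov

sum-nonneg : ∀ {n} {f : Vector ℚ n} → Nonneg f → 0ℚ ≤ℚ sum f
sum-nonneg {n} {f} 0≤f = subst (_≤ℚ sum f) (sum-replicate-zero n) (sum-mono 0≤f)

module _ {n : ℕ} {A : List (Vector ℚ n)} where

  withObjective : Vector ℚ n → Vector ℚ (suc n)
  withObjective x = snoc x (sum x)

  withObjective-nonneg : ∀ {x} → Feasible A x → Nonneg (withObjective x)
  withObjective-nonneg (box , _) = snoc-nonneg (proj₁ ∘ box) (sum-nonneg (proj₁ ∘ box))

  withObjective-sat : ∀ {x} → Feasible A x → Sat (coverProgram A) (withObjective x)
  withObjective-sat {x} feas = Equivalence.from (coverProgram⇔ (withObjective x) A (withObjective-nonneg feas))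
    ( Feasible-cong {A = A} (λ i → sym (snoc-inject₁ x (sum x) i)) feas
    , ≤-reflexive (trans (sum-cong-≗ (snoc-inject₁ x (sum x))) (sym (snoc-fromℕ x (sum x)))))

  -- The last coordinate of the minimiser lies above its own sum and, by comparison with
  -- `withObjective y`, below the sum of every feasible `y`.
  optimum : ∀ {p} → Feasible A p → ∃[ x ] (Feasible A x × (∀ y → Feasible A y → sum x ≤ℚ sum y))
  optimum {p} feas =
    let z , 0≤z , satz , least =
          minimiseLast n (coverProgram A) (withObjective p) (withObjective-nonneg feas) (withObjective-sat feas)
        feasz , Σ≤r = Equivalence.to (coverProgram⇔ z A 0≤z) satz
    in z ∘ inject₁ , feasz , λ y feasy → ≤-trans Σ≤r (subst (z (fromℕ n) ≤ℚ_)
         (snoc-fromℕ y (sum y)) (least (withObjective y) (withObjective-nonneg feasy) (withObjective-sat feasy)))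

-- Weights as linear forms.

sumFin≡sum : ∀ {n} (f : Vector ℚ n) → sumFin n f ≡ sum f
sumFin≡sum {zero}  f = refl
sumFin≡sum {suc n} f = cong (f zero +_) (sumFin≡sum (f ∘ suc))

sumV≡∑∑ : ∀ {s t} (f : Vtx s t → ℚ) → sumV s t f ≡ ∑[ i < s ] ∑[ j < t ] f (i , j)
sumV≡∑∑ {s} f = trans (sumFin≡sum {s} _) (sum-cong-≗ λ i → sumFin≡sum (λ j → f (i , j)))

sumV-cong : ∀ {s t} {f g : Vtx s t → ℚ} → (∀ z → f z ≡ g z) → sumV s t f ≡ sumV s t g
sumV-cong {s} {t} {f} {g} f≗g = trans (sumV≡∑∑ f)
  (trans (sum-cong-≗ λ i → sum-cong-≗ λ j → f≗g (i , j)) (sym (sumV≡∑∑ g)))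

-- The summand of weightResolving is local to its definition; unification recovers it from the sum.
summand : ∀ {s t f r} → sumV s t f ≡ r → Vtx s t → ℚ
summand {f = f} _ = f

unless : ∀ {P : Set} → Dec P → ℚ
unless (yes _) = 0ℚ
unless (no _)  = 1ℚ

-- The 0/1 coefficient row by which the resolving condition for `x` and `y` becomes a covering
-- constraint.
separation : ∀ {s t} → (Vtx s t → Vtx s t → ℕ) → Vtx s t → Vtx s t → Vtx s t → ℚ
separation δ x y z = unless (δ x z ℕ.≟ δ y z)

module _ {s t : ℕ} (δ : Vtx s t → Vtx s t → ℕ) (g : Vtx s t → ℚ) (x y : Vtx s t) where

  summand≡ : ∀ z → summand {s} {t} (refl {x = weightResolving s t δ g x y}) z ≡ separation δ x y z * g z
  summand≡ z with δ x z ℕ.≟ δ y z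
  ... | yes _ = sym (*-zeroˡ (g z))
  ... | no _  = sym (*-identityˡ (g z))

  weight≡ : weightResolving s t δ g x y ≡ sumV s t (λ z → separation δ x y z * g z)
  weight≡ = sumV-cong summand≡

-- Natural numbers in ℚ and sums over blocks.

toℚᵘ-ℕ→ℚ : ∀ n → toℚᵘ (ℕ→ℚ n) ≃ mkℚᵘ (pos n) 0
toℚᵘ-ℕ→ℚ n = toℚᵘ-fromℚᵘ (mkℚᵘ (pos n) 0)

-- Operations on ℚ normalise by a gcd that does not compute on variables. In ℚᵘ the claim is an
-- integer identity with denominators 1.
ℕ→ℚ-+ : ∀ m n → ℕ→ℚ (m ℕ.+ n) ≡ ℕ→ℚ m + ℕ→ℚ n
ℕ→ℚ-+ m n = toℚᵘ-injective (begin
  toℚᵘ (ℕ→ℚ (m ℕ.+ n))                    ≈⟨ toℚᵘ-ℕ→ℚ (m ℕ.+ n) ⟩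
  mkℚᵘ (pos (m ℕ.+ n)) 0                    ≈⟨ *≡* (cong (ℤ._* pos 1) (cong₂ ℤ._+_ (ℤ.*-identityʳ (pos m)) (ℤ.*-identityʳ (pos n)))) ⟨
  mkℚᵘ (pos m) 0 ℚᵘ.+ mkℚᵘ (pos n) 0          ≈⟨ ℚᵘ.+-cong (toℚᵘ-ℕ→ℚ m) (toℚᵘ-ℕ→ℚ n) ⟨
  toℚᵘ (ℕ→ℚ m) ℚᵘ.+ toℚᵘ (ℕ→ℚ n)          ≈⟨ toℚᵘ-homo-+ (ℕ→ℚ m) (ℕ→ℚ n) ⟨
  toℚᵘ (ℕ→ℚ m + ℕ→ℚ n)                    ∎)
  where open ℚᵘ.≃-Reasoning

ℕ→ℚ-* : ∀ m n → ℕ→ℚ (m ℕ.* n) ≡ ℕ→ℚ m * ℕ→ℚ n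
ℕ→ℚ-* m n = toℚᵘ-injective (begin
  toℚᵘ (ℕ→ℚ (m ℕ.* n))                    ≈⟨ toℚᵘ-ℕ→ℚ (m ℕ.* n) ⟩
  mkℚᵘ (pos (m ℕ.* n)) 0                    ≈⟨ *≡* (cong (ℤ._* pos 1) (ℤ.pos-* m n)) ⟩
  mkℚᵘ (pos m) 0 ℚᵘ.* mkℚᵘ (pos n) 0          ≈⟨ ℚᵘ.*-cong (toℚᵘ-ℕ→ℚ m) (toℚᵘ-ℕ→ℚ n) ⟨
  toℚᵘ (ℕ→ℚ m) ℚᵘ.* toℚᵘ (ℕ→ℚ n)          ≈⟨ toℚᵘ-homo-* (ℕ→ℚ m) (ℕ→ℚ n) ⟨
  toℚᵘ (ℕ→ℚ m * ℕ→ℚ n)                    ∎)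
  where open ℚᵘ.≃-Reasoning

ℕ→ℚ≡mkℚ : ∀ n → ℕ→ℚ n ≡ mkℚ (pos n) 0 (coprime-sym (1-coprimeTo n))
ℕ→ℚ≡mkℚ n = normalize-coprime (coprime-sym (1-coprimeTo n))

ℕ→ℚ-mono-≤ : ∀ {m n} → m ≤ n → ℕ→ℚ m ≤ℚ ℕ→ℚ n
ℕ→ℚ-mono-≤ {m} {n} m≤n = subst₂ _≤ℚ_ (sym (ℕ→ℚ≡mkℚ m)) (sym (ℕ→ℚ≡mkℚ n))
  (*≤* (ℤ.*-monoʳ-≤-nonNeg (pos 1) (ℤ.+≤+ m≤n)))

ℕ→ℚ-mono-< : ∀ {m n} → m < n → ℕ→ℚ m <ℚ ℕ→ℚ n
ℕ→ℚ-mono-< {m} {n} m<n = subst₂ _<ℚ_ (sym (ℕ→ℚ≡mkℚ m)) (sym (ℕ→ℚ≡mkℚ n))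
  (*<* (ℤ.*-monoʳ-<-pos (pos 1) (ℤ.+<+ m<n)))

0≤ℕ→ℚ : ∀ n → 0ℚ ≤ℚ ℕ→ℚ n
0≤ℕ→ℚ n = ℕ→ℚ-mono-≤ {0} {n} ℕ.z≤n

-- Since the denominator is at least 1, a nonnegative rational is at most its numerator.
≤ℕ→ℚ : ∀ p → ∃[ n ] p ≤ℚ ℕ→ℚ n
≤ℕ→ℚ (mkℚ (-[1+ _ ]) _ _) = 0 , *≤* ℤ.-≤+
≤ℕ→ℚ p@(mkℚ (pos n) d _)    = n , subst (p ≤ℚ_) (sym (ℕ→ℚ≡mkℚ n))
  (*≤* (ℤ.*-monoˡ-≤-nonNeg (pos n) {pos 1} {pos (suc d)} (ℤ.+≤+ (ℕ.s≤s ℕ.z≤n))))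

sum-const : ∀ n p → ∑[ i < n ] p ≡ ℕ→ℚ n * p
sum-const zero    p = sym (*-zeroˡ p)
sum-const (suc n) p = begin
  p + ∑[ i < n ] p          ≡⟨ cong₂ _+_ (sym (*-identityˡ p)) (sum-const n p) ⟩
  1ℚ * p + ℕ→ℚ n * p        ≡⟨ *-distribʳ-+ p 1ℚ (ℕ→ℚ n) ⟨
  (1ℚ + ℕ→ℚ n) * p          ≡⟨ cong (_* p) (ℕ→ℚ-+ 1 n) ⟨
  ℕ→ℚ (suc n) * p           ∎
  where open ≡-Reasoning

sum-++ : ∀ m {n} (f : Vector ℚ (m ℕ.+ n)) → sum f ≡ ∑[ i < m ] f (i ↑ˡ n) + ∑[ j < n ] f (m ↑ʳ j)
sum-++ zero    f = sym (+-identityˡ _)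
sum-++ (suc m) f = trans (cong (f zero +_) (sum-++ m (f ∘ suc))) (sym (+-assoc (f zero) _ _))

sum-combine : ∀ m {n} (f : Vector ℚ (m ℕ.* n)) → sum f ≡ ∑[ i < m ] ∑[ j < n ] f (combine i j)
sum-combine zero        f = refl
sum-combine (suc m) {n} f = trans (sum-++ n f) (cong (sum (λ j → f (j ↑ˡ (m ℕ.* n))) +_) (sum-combine m (f ∘ (n ↑ʳ_))))

-- Minimum weight of a resolving function

module _ {s t : ℕ} (δ : Vtx s t → Vtx s t → ℕ) where
  private
    n = s ℕ.* t

    vertex : Fin n → Vtx s t
    vertex = remQuot {s} t

    vertex-combine : ∀ z → vertex (uncurry combine z) ≡ z
    vertex-combine (i , j) = Fin.remQuot-combine i j

  -- Numbering the vertices by a single index makes the total weight the objective of the linear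
  -- program.
  sumV≡sum : ∀ (f : Vtx s t → ℚ) → sumV s t f ≡ sum (f ∘ vertex)
  sumV≡sum f = trans (sumV≡∑∑ f) (trans
    (sum-cong-≗ λ i → sum-cong-≗ λ j → cong f (sym (vertex-combine (i , j))))
    (sym (sum-combine s (f ∘ vertex))))

  pairs : List (Fin n × Fin n)
  pairs = filter (λ (i , j) → ¬? (i Fin.≟ j)) (cartesianProduct (allFin n) (allFin n))

  separations : List (Vector ℚ n)
  separations = map (λ (i , j) → separation δ (vertex i) (vertex j) ∘ vertex) pairs

  vertex-injective : ∀ {i j} → vertex i ≡ vertex j → i ≡ j
  vertex-injective {i} {j} eq = trans (sym (Fin.combine-remQuot {s} t i)) (trans (cong (uncurry combine) eq) (Fin.combine-remQuot {s} t j))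

  weight≡sum : ∀ g x y → weightResolving s t δ g x y ≡ ∑[ k < n ] (separation δ x y (vertex k) * g (vertex k))
  weight≡sum g x y = trans (weight≡ δ g x y) (sumV≡sum λ z → separation δ x y z * g z)

  resolving⇔feasible : ∀ g → IsResolvingFn s t δ g ⇔ Feasible separations (g ∘ vertex)
  resolving⇔feasible g = mk⇔ to from
    where
    to : IsResolvingFn s t δ g → Feasible separations (g ∘ vertex)
    to (box , resolves) = box ∘ vertex , All.map⁺ (All.tabulate covered)
      where
      covered : ∀ {ij} → ij ∈ pairs → 1ℚ ≤ℚ ∑[ k < n ] (separation δ (vertex (proj₁ ij)) (vertex (proj₂ ij)) (vertex k) * g (vertex k))
      covered {i , j} ij∈ = subst (1ℚ ≤ℚ_) (weight≡sum g (vertex i) (vertex j))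
        (resolves (vertex i) (vertex j) (proj₂ (∈-filter⁻ (λ (i , j) → ¬? (i Fin.≟ j)) {xs = cartesianProduct (allFin n) (allFin n)} ij∈) ∘ vertex-injective))
    from : Feasible separations (g ∘ vertex) → IsResolvingFn s t δ g
    from (box , cov) = (λ z → subst (λ v → 0ℚ ≤ℚ g v × g v ≤ℚ 1ℚ) (vertex-combine z) (box (uncurry combine z))) , resolves
      where
      resolves : ∀ x y → x ≢ y → 1ℚ ≤ℚ weightResolving s t δ g x y
      resolves x y x≢y = subst₂ (λ x y → 1ℚ ≤ℚ weightResolving s t δ g x y) (vertex-combine x) (vertex-combine y)
        (subst (1ℚ ≤ℚ_) (sym (weight≡sum g (vertex i) (vertex j))) (All.lookup (All.map⁻ cov)
          (∈-filter⁺ (λ (i , j) → ¬? (i Fin.≟ j)) (∈-cartesianProduct⁺ (∈-allFin i) (∈-allFin j)) i≢j)))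
        where
        i = uncurry combine x
        j = uncurry combine y
        i≢j : i ≢ j
        i≢j i≡j = x≢y (trans (sym (vertex-combine x)) (trans (cong vertex i≡j) (vertex-combine y)))

  -- Any resolving function serves as the feasible point that `optimum` asks for; the optimal vector
  -- is then read back as a function on vertices.
  minimum-exists : ∀ {g} → IsResolvingFn s t δ g → ∃[ r ] IsMinWeight s t δ r
  minimum-exists {g} resolving =
    let x , feas , least = optimum {A = separations} (Equivalence.to (resolving⇔feasible g) resolving)
    in sum x , attained x feas , λ k resk → subst (sum x ≤ℚ_) (sym (sumV≡sum k)) (least (k ∘ vertex) (Equivalence.to (resolving⇔feasible k) resk))
    where
    attained : ∀ x → Feasible separations x → Σ (Vtx s t → ℚ) λ h → IsResolvingFn s t δ h × sumV s t h ≡ sum x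
    attained x feas = h
      , Equivalence.from (resolving⇔feasible h) (Feasible-cong {A = separations} {x = x} {y = h ∘ vertex} (sym ∘ h∘vertex≗x) feas)
      , trans (sumV≡sum h) (sum-cong-≗ h∘vertex≗x)
      where
      h : Vtx s t → ℚ
      h = x ∘ uncurry combine
      h∘vertex≗x : ∀ i → h (vertex i) ≡ x i
      h∘vertex≗x i = cong x (Fin.combine-remQuot {s} t i)

-- Distances

∣-∣≡ : ∀ m n → ∣ m - n ∣ ≡ ℕ.∣ m - n ∣
∣-∣≡ zero    zero    = refl
∣-∣≡ zero    (suc n) = refl
∣-∣≡ (suc m) zero    = ℕ.+-identityʳ (suc m)
∣-∣≡ (suc m) (suc n) = ∣-∣≡ m n

∣-∣-comm : ∀ m n → ∣ m - n ∣ ≡ ∣ n - m ∣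
∣-∣-comm m n = ℕ.+-comm (m ℕ.∸ n) (n ℕ.∸ m)

m≤n⇒∣n-m∣≡n∸m : ∀ {m n} → m ≤ n → ∣ n - m ∣ ≡ n ℕ.∸ m
m≤n⇒∣n-m∣≡n∸m {m} {n} m≤n = trans (∣-∣≡ n m) (ℕ.m≤n⇒∣n-m∣≡n∸m m≤n)

m≤n⇒∣m-n∣≡n∸m : ∀ {m n} → m ≤ n → ∣ m - n ∣ ≡ n ℕ.∸ m
m≤n⇒∣m-n∣≡n∸m {m} {n} m≤n = trans (∣-∣-comm m n) (m≤n⇒∣n-m∣≡n∸m m≤n)

n∸m≤∣u-m∣+∣u-n∣ : ∀ u m n → n ℕ.∸ m ≤ ∣ u - m ∣ ℕ.+ ∣ u - n ∣
n∸m≤∣u-m∣+∣u-n∣ u m n = begin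
  n ℕ.∸ m                          ≤⟨ ℕ.m≤n+m _ _ ⟩
  ∣ m - n ∣                        ≡⟨ ∣-∣≡ m n ⟩
  ℕ.∣ m - n ∣                      ≤⟨ ℕ.∣-∣-triangle m u n ⟩
  ℕ.∣ m - u ∣ ℕ.+ ℕ.∣ u - n ∣      ≡⟨ cong₂ ℕ._+_ (∣-∣≡ m u) (∣-∣≡ u n) ⟨
  ∣ m - u ∣ ℕ.+ ∣ u - n ∣          ≡⟨ cong (ℕ._+ ∣ u - n ∣) (∣-∣-comm m u) ⟩
  ∣ u - m ∣ ℕ.+ ∣ u - n ∣          ∎
  where open ℕ.≤-Reasoning

-- For `u` outside the interval, the distance to the farther endpoint alone exceeds `n ∸ m`.
between : ∀ {m n u} → m ≤ n → ∣ u - m ∣ ℕ.+ ∣ u - n ∣ ≤ n ℕ.∸ m → m ≤ u × u ≤ n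
between {m} {n} {u} m≤n tight = ℕ.≮⇒≥ u≮m , ℕ.≮⇒≥ n≮u
  where
  u≮m : ¬ (u < m)
  u≮m u<m = ℕ.<⇒≱ (ℕ.∸-monoʳ-< u<m m≤n) (ℕ.≤-trans
    (ℕ.≤-reflexive (sym (m≤n⇒∣m-n∣≡n∸m (ℕ.≤-trans (ℕ.<⇒≤ u<m) m≤n)))) (ℕ.m+n≤o⇒n≤o (∣ u - m ∣) tight))
  n≮u : ¬ (n < u)
  n≮u n<u = ℕ.<⇒≱ (ℕ.∸-monoˡ-< n<u m≤n) (ℕ.≤-trans
    (ℕ.≤-reflexive (sym (m≤n⇒∣n-m∣≡n∸m (ℕ.≤-trans m≤n (ℕ.<⇒≤ n<u))))) (ℕ.m+n≤o⇒m≤o (∣ u - m ∣) tight))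

distances-between : ∀ {m n u} → m ≤ u → u ≤ n → ∣ u - m ∣ ℕ.+ ∣ u - n ∣ ≡ n ℕ.∸ m
distances-between {m} {n} {u} m≤u u≤n = begin
  ∣ u - m ∣ ℕ.+ ∣ u - n ∣        ≡⟨ cong₂ ℕ._+_ (m≤n⇒∣n-m∣≡n∸m m≤u) (m≤n⇒∣m-n∣≡n∸m u≤n) ⟩
  (u ℕ.∸ m) ℕ.+ (n ℕ.∸ u)        ≡⟨ ℕ.+-comm (u ℕ.∸ m) (n ℕ.∸ u) ⟩
  (n ℕ.∸ u) ℕ.+ (u ℕ.∸ m)        ≡⟨ ℕ.+-∸-assoc (n ℕ.∸ u) m≤u ⟨
  ((n ℕ.∸ u) ℕ.+ u) ℕ.∸ m        ≡⟨ cong (ℕ._∸ m) (ℕ.m∸n+n≡m u≤n) ⟩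
  n ℕ.∸ m                        ∎
  where open ≡-Reasoning

+-cancel-≥ : ∀ {a b p q} → a ℕ.+ b ≡ p ℕ.+ q → q ≤ b → a ≤ p
+-cancel-≥ {a} {b} {p} {q} eq q≤b = ℕ.+-cancelʳ-≤ q a p (ℕ.≤-trans (ℕ.+-monoʳ-≤ a q≤b) (ℕ.≤-reflexive eq))

-- Equal distance sums to two opposite corners confine (u , v) to the box; inside it the distances to adjacent
-- corners on a diagonal side determine u, then v.
three-corners : ∀ {i₀ i₁ j₀ j₁ i j u v} → i₀ ≤ i → i ≤ i₁ → j₀ ≤ j → j ≤ j₁ →
  ∣ i - i₀ ∣ ℕ.+ ∣ j - j₀ ∣ ≡ ∣ u - i₀ ∣ ℕ.+ ∣ v - j₀ ∣ →
  ∣ i - i₁ ∣ ℕ.+ ∣ j - j₁ ∣ ≡ ∣ u - i₁ ∣ ℕ.+ ∣ v - j₁ ∣ →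
  ∣ i - i₀ ∣ ℕ.+ ∣ j - j₁ ∣ ≡ ∣ u - i₀ ∣ ℕ.+ ∣ v - j₁ ∣ →
  i ≡ u × j ≡ v
three-corners {i₀} {i₁} {j₀} {j₁} {i} {j} {u} {v} i₀≤i i≤i₁ j₀≤j j≤j₁ e₀₀ e₁₁ e₀₁ = i≡u , j≡v
  where
  interchange : ∀ a b c d → (a ℕ.+ b) ℕ.+ (c ℕ.+ d) ≡ (a ℕ.+ c) ℕ.+ (b ℕ.+ d)
  interchange = solve-∀
  i₀≤i₁ = ℕ.≤-trans i₀≤i i≤i₁
  j₀≤j₁ = ℕ.≤-trans j₀≤j j≤j₁

  -- The equations at two opposite corners add up to a sum in which rows and columns separate.
  perimeter : (∣ u - i₀ ∣ ℕ.+ ∣ u - i₁ ∣) ℕ.+ (∣ v - j₀ ∣ ℕ.+ ∣ v - j₁ ∣) ≡ (i₁ ℕ.∸ i₀) ℕ.+ (j₁ ℕ.∸ j₀)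
  perimeter = begin
    (∣ u - i₀ ∣ ℕ.+ ∣ u - i₁ ∣) ℕ.+ (∣ v - j₀ ∣ ℕ.+ ∣ v - j₁ ∣)  ≡⟨ interchange (∣ u - i₀ ∣) _ _ _ ⟩
    (∣ u - i₀ ∣ ℕ.+ ∣ v - j₀ ∣) ℕ.+ (∣ u - i₁ ∣ ℕ.+ ∣ v - j₁ ∣)  ≡⟨ cong₂ ℕ._+_ e₀₀ e₁₁ ⟨
    (∣ i - i₀ ∣ ℕ.+ ∣ j - j₀ ∣) ℕ.+ (∣ i - i₁ ∣ ℕ.+ ∣ j - j₁ ∣)  ≡⟨ interchange (∣ i - i₀ ∣) _ _ _ ⟩
    (∣ i - i₀ ∣ ℕ.+ ∣ i - i₁ ∣) ℕ.+ (∣ j - j₀ ∣ ℕ.+ ∣ j - j₁ ∣)  ≡⟨ cong₂ ℕ._+_ (distances-between i₀≤i i≤i₁) (distances-between j₀≤j j≤j₁) ⟩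
    (i₁ ℕ.∸ i₀) ℕ.+ (j₁ ℕ.∸ j₀)                                  ∎
    where open ≡-Reasoning

  -- By the triangle inequality the column part is at least its side length, so the row part cannot
  -- exceed its own.
  u-between : i₀ ≤ u × u ≤ i₁
  u-between = between i₀≤i₁ (+-cancel-≥ perimeter (n∸m≤∣u-m∣+∣u-n∣ v j₀ j₁))
  v-between : j₀ ≤ v × v ≤ j₁
  v-between = between j₀≤j₁ (+-cancel-≥
    (trans (ℕ.+-comm (∣ v - j₀ ∣ ℕ.+ ∣ v - j₁ ∣) _) (trans perimeter (ℕ.+-comm (i₁ ℕ.∸ i₀) _)))
    (n∸m≤∣u-m∣+∣u-n∣ u i₀ i₁))

  -- The two corners in row `i₀` see the column from opposite ends. Their column distances add to
  -- `j₁ ∸ j₀` for both points, which leaves twice the row distance.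
  side : 2 ℕ.* ∣ i - i₀ ∣ ℕ.+ (j₁ ℕ.∸ j₀) ≡ 2 ℕ.* ∣ u - i₀ ∣ ℕ.+ (j₁ ℕ.∸ j₀)
  side = begin
    2 ℕ.* ∣ i - i₀ ∣ ℕ.+ (j₁ ℕ.∸ j₀)                             ≡⟨ cong (2 ℕ.* ∣ i - i₀ ∣ ℕ.+_) (distances-between j₀≤j j≤j₁) ⟨
    2 ℕ.* ∣ i - i₀ ∣ ℕ.+ (∣ j - j₀ ∣ ℕ.+ ∣ j - j₁ ∣)             ≡⟨ regroup (∣ i - i₀ ∣) _ _ ⟩
    (∣ i - i₀ ∣ ℕ.+ ∣ j - j₀ ∣) ℕ.+ (∣ i - i₀ ∣ ℕ.+ ∣ j - j₁ ∣)  ≡⟨ cong₂ ℕ._+_ e₀₀ e₀₁ ⟩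
    (∣ u - i₀ ∣ ℕ.+ ∣ v - j₀ ∣) ℕ.+ (∣ u - i₀ ∣ ℕ.+ ∣ v - j₁ ∣)  ≡⟨ regroup (∣ u - i₀ ∣) _ _ ⟨
    2 ℕ.* ∣ u - i₀ ∣ ℕ.+ (∣ v - j₀ ∣ ℕ.+ ∣ v - j₁ ∣)             ≡⟨ cong (2 ℕ.* ∣ u - i₀ ∣ ℕ.+_) (distances-between (proj₁ v-between) (proj₂ v-between)) ⟩
    2 ℕ.* ∣ u - i₀ ∣ ℕ.+ (j₁ ℕ.∸ j₀)                             ∎
    where
    open ≡-Reasoning
    regroup : ∀ a b c → 2 ℕ.* a ℕ.+ (b ℕ.+ c) ≡ (a ℕ.+ b) ℕ.+ (a ℕ.+ c)
    regroup = solve-∀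

  ∣i-i₀∣≡∣u-i₀∣ : ∣ i - i₀ ∣ ≡ ∣ u - i₀ ∣
  ∣i-i₀∣≡∣u-i₀∣ = ℕ.*-cancelˡ-≡ (∣ i - i₀ ∣) (∣ u - i₀ ∣) 2 (ℕ.+-cancelʳ-≡ (j₁ ℕ.∸ j₀) _ _ side)

  ∣-∣-cancel : ∀ {m p q} → m ≤ p → m ≤ q → ∣ p - m ∣ ≡ ∣ q - m ∣ → p ≡ q
  ∣-∣-cancel m≤p m≤q eq = ℕ.∸-cancelʳ-≡ m≤p m≤q (trans (sym (m≤n⇒∣n-m∣≡n∸m m≤p)) (trans eq (m≤n⇒∣n-m∣≡n∸m m≤q)))

  i≡u : i ≡ u
  i≡u = ∣-∣-cancel i₀≤i (proj₁ u-between) ∣i-i₀∣≡∣u-i₀∣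
  j≡v : j ≡ v
  j≡v = ∣-∣-cancel j₀≤j (proj₁ v-between)
    (ℕ.+-cancelˡ-≡ (∣ u - i₀ ∣) _ _ (trans (cong (ℕ._+ ∣ j - j₀ ∣) (sym ∣i-i₀∣≡∣u-i₀∣)) e₀₀))

-- Upper bounds from landmarks

term≤sum : ∀ {n} {f : Vector ℚ n} → Nonneg f → ∀ k → f k ≤ℚ sum f
term≤sum {f = f} 0≤f zero    = subst (_≤ℚ sum f) (+-identityʳ (f zero)) (+-monoʳ-≤ (f zero) (sum-nonneg (0≤f ∘ suc)))
term≤sum {f = f} 0≤f (suc k) = ≤-trans (term≤sum (0≤f ∘ suc) k)
  (subst (_≤ℚ sum f) (+-identityˡ _) (+-monoˡ-≤ _ (0≤f zero)))

*-nonneg : ∀ {p q} → 0ℚ ≤ℚ p → 0ℚ ≤ℚ q → 0ℚ ≤ℚ p * q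
*-nonneg {p} {q} 0≤p 0≤q = subst (_≤ℚ p * q) (*-zeroˡ q) (*-monoʳ-≤-nonNeg q {{nonNegative 0≤q}} 0≤p)

*-mono-≤ : ∀ {p q r s} → 0ℚ ≤ℚ q → 0ℚ ≤ℚ r → p ≤ℚ q → r ≤ℚ s → p * r ≤ℚ q * s
*-mono-≤ {p} {q} {r} {s} 0≤q 0≤r p≤q r≤s = ≤-trans
  (*-monoʳ-≤-nonNeg r {{nonNegative 0≤r}} p≤q) (*-monoˡ-≤-nonNeg q {{nonNegative 0≤q}} r≤s)

-- Points of the image are counted once: clamped landmarks may coincide, and the weight must stay at
-- most 1.
imageIndicator : ∀ {n s} → (Fin n → Fin s) → Vector ℚ s
imageIndicator p i = indicator (Fin.any? λ a → p a Fin.≟ i)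

imageIndicator-image : ∀ {n s} (p : Fin n → Fin s) a → imageIndicator p (p a) ≡ 1ℚ
imageIndicator-image p a with Fin.any? (λ b → p b Fin.≟ p a)
... | yes _ = refl
... | no ∄  = contradiction (a , refl) ∄

-- A union bound: the indicator of the image is at most the sum of the indicators of the single
-- points, each of total 1.
sum-imageIndicator : ∀ {n s} (p : Fin n → Fin s) → sum (imageIndicator p) ≤ℚ ℕ→ℚ n
sum-imageIndicator {n} {s} p = begin
  sum (imageIndicator p)                                    ≤⟨ sum-mono pointwise ⟩
  ∑[ i < s ] ∑[ a < n ] (indicator (p a Fin.≟ i) * 1ℚ)      ≡⟨ ∑-comm (λ i a → indicator (p a Fin.≟ i) * 1ℚ) ⟩
  ∑[ a < n ] ∑[ i < s ] (indicator (p a Fin.≟ i) * 1ℚ)      ≡⟨ sum-cong-≗ (λ a → sum-indicator (p a) λ _ → 1ℚ) ⟩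
  ∑[ a < n ] 1ℚ                                             ≡⟨ sum-const n 1ℚ ⟩
  ℕ→ℚ n * 1ℚ                                                ≡⟨ *-identityʳ (ℕ→ℚ n) ⟩
  ℕ→ℚ n                                                     ∎
  where
  open ℚ.≤-Reasoning
  hit : ∀ i a → p a ≡ i → 1ℚ ≤ℚ indicator (p a Fin.≟ i) * 1ℚ
  hit i a pa≡i with p a Fin.≟ i
  ... | yes _    = ≤-refl
  ... | no pa≢i  = contradiction pa≡i pa≢i
  nonneg : ∀ i a → 0ℚ ≤ℚ indicator (p a Fin.≟ i) * 1ℚ
  nonneg i a = *-nonneg (indicator-nonneg (p a Fin.≟ i)) (≤ᵇ⇒≤ _)
  pointwise : ∀ i → imageIndicator p i ≤ℚ ∑[ a < n ] (indicator (p a Fin.≟ i) * 1ℚ)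
  pointwise i with Fin.any? (λ a → p a Fin.≟ i)
  ... | yes (a , pa≡i) = ≤-trans (hit i a pa≡i) (term≤sum (nonneg i) a)
  ... | no _           = sum-nonneg (nonneg i)

unless-nonneg : ∀ {P : Set} (d : Dec P) → 0ℚ ≤ℚ unless d
unless-nonneg (yes _) = ≤-refl
unless-nonneg (no _)  = ≤ᵇ⇒≤ _

weight≡∑∑ : ∀ {s t} δ g x y → weightResolving s t δ g x y ≡ ∑[ i < s ] ∑[ j < t ] (separation δ x y (i , j) * g (i , j))
weight≡∑∑ δ g x y = trans (weight≡ δ g x y) (sumV≡∑∑ λ z → separation δ x y z * g z)

separated : ∀ {s t} (δ : Vtx s t → Vtx s t → ℕ) x y z → δ x z ≢ δ y z → separation δ x y z ≡ 1ℚ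
separated δ x y z δ≢ with δ x z ℕ.≟ δ y z
... | yes δ≡ = contradiction δ≡ δ≢
... | no _  = refl

unseparated : ∀ {s t} (δ : Vtx s t → Vtx s t → ℕ) x y z → δ x z ≡ δ y z → separation δ x y z ≡ 0ℚ
unseparated δ x y z δ≡ with δ x z ℕ.≟ δ y z
... | yes _ = refl
... | no δ≢ = contradiction δ≡ δ≢

-- One landmark that distinguishes `x` from `y` already contributes 1. The weight is a product of a
-- row factor and a column factor, so its total factors as well.
landmarks-resolve : ∀ {s t m n} (δ : Vtx s t → Vtx s t → ℕ) (p : Fin m → Fin s) (q : Fin n → Fin t) →
  (∀ x y → x ≢ y → ∃[ a ] ∃[ b ] δ x (p a , q b) ≢ δ y (p a , q b)) →
  Σ (Vtx s t → ℚ) λ h → IsResolvingFn s t δ h × sumV s t h ≤ℚ ℕ→ℚ (m ℕ.* n)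
landmarks-resolve {s} {t} {m} {n} δ p q separates = h , (box , resolves) , total
  where
  u = imageIndicator p
  v = imageIndicator q

  h : Vtx s t → ℚ
  h (i , j) = u i * v j

  0≤u : Nonneg u
  0≤u i = indicator-nonneg (Fin.any? λ a → p a Fin.≟ i)
  0≤v : Nonneg v
  0≤v j = indicator-nonneg (Fin.any? λ b → q b Fin.≟ j)
  u≤1 : ∀ i → u i ≤ℚ 1ℚ
  u≤1 i = indicator≤1 (Fin.any? λ a → p a Fin.≟ i)
  v≤1 : ∀ j → v j ≤ℚ 1ℚ
  v≤1 j = indicator≤1 (Fin.any? λ b → q b Fin.≟ j)

  box : ∀ z → 0ℚ ≤ℚ h z × h z ≤ℚ 1ℚ
  box (i , j) = *-nonneg (0≤u i) (0≤v j) , *-mono-≤ (≤ᵇ⇒≤ _) (0≤v j) (u≤1 i) (v≤1 j)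

  resolves : ∀ x y → x ≢ y → 1ℚ ≤ℚ weightResolving s t δ h x y
  resolves x y x≢y with separates x y x≢y
  ... | a , b , δ≢ = begin
    1ℚ                                                                    ≡⟨ *-identityˡ 1ℚ ⟨
    1ℚ * (1ℚ * 1ℚ)                                                        ≡⟨ cong₂ _*_ (separated δ x y (p a , q b) δ≢) (cong₂ _*_ (imageIndicator-image p a) (imageIndicator-image q b)) ⟨
    separation δ x y (p a , q b) * h (p a , q b)                          ≤⟨ term≤sum (nonneg (p a)) (q b) ⟩
    ∑[ j < t ] (separation δ x y (p a , j) * h (p a , j))                 ≤⟨ term≤sum (sum-nonneg ∘ nonneg) (p a) ⟩
    ∑[ i < s ] ∑[ j < t ] (separation δ x y (i , j) * h (i , j))          ≡⟨ weight≡∑∑ δ h x y ⟨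
    weightResolving s t δ h x y                                           ∎
    where
    open ℚ.≤-Reasoning
    nonneg : ∀ i j → 0ℚ ≤ℚ separation δ x y (i , j) * h (i , j)
    nonneg i j = *-nonneg (unless-nonneg (δ x (i , j) ℕ.≟ δ y (i , j))) (proj₁ (box (i , j)))

  total : sumV s t h ≤ℚ ℕ→ℚ (m ℕ.* n)
  total = begin
    sumV s t h                           ≡⟨ sumV≡∑∑ h ⟩
    ∑[ i < s ] ∑[ j < t ] (u i * v j)    ≡⟨ sum-cong-≗ (λ i → *-distribˡ-sum (u i) v) ⟨
    ∑[ i < s ] (u i * sum v)             ≡⟨ *-distribʳ-sum (sum v) u ⟨
    sum u * sum v                        ≤⟨ *-mono-≤ (0≤ℕ→ℚ m) (sum-nonneg 0≤v) (sum-imageIndicator p) (sum-imageIndicator q) ⟩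
    ℕ→ℚ m * ℕ→ℚ n                        ≡⟨ ℕ→ℚ-* m n ⟨
    ℕ→ℚ (m ℕ.* n)                        ∎
    where open ℚ.≤-Reasoning

Vtx-≡ : ∀ {s t} {x y : Vtx s t} → toℕ (proj₁ x) ≡ toℕ (proj₁ y) → toℕ (proj₂ x) ≡ toℕ (proj₂ y) → x ≡ y
Vtx-≡ eq₁ eq₂ = cong₂ _,_ (Fin.toℕ-injective eq₁) (Fin.toℕ-injective eq₂)

-- Lattices of landmarks and their cells.

module _ (s : ℕ) .{{_ : ℕ.NonZero s}} (m q : ℕ) where

  -- Multiples of `q`, clamped to the last index so that the final interval also ends inside the
  -- path.
  landmark : Fin (suc m) → Fin s
  landmark a = fromℕ< {m = (toℕ a ℕ.* q) ℕ.⊓ ℕ.pred s}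
    (ℕ.≤-<-trans (ℕ.m⊓n≤n (toℕ a ℕ.* q) (ℕ.pred s)) (ℕ.≤-reflexive (ℕ.suc-pred s)))

  toℕ-landmark : ∀ a → toℕ (landmark a) ≡ (toℕ a ℕ.* q) ℕ.⊓ ℕ.pred s
  toℕ-landmark a = Fin.toℕ-fromℕ< _

  bracket : .{{_ : ℕ.NonZero q}} → s ≤ m ℕ.* q → ∀ i → ∃[ a ] ∃[ b ]
    (toℕ (landmark a) ≤ toℕ i × toℕ i ≤ toℕ (landmark b) × toℕ (landmark b) ≤ toℕ (landmark a) ℕ.+ q)
  bracket s≤m*q i = a , b , a≤i , i≤b , b≤a+q
    where
    n = toℕ i / q
    n<m : n < m
    n<m = m<n*o⇒m/o<n (ℕ.<-≤-trans (Fin.toℕ<n i) s≤m*q)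
    a = fromℕ< (ℕ.m≤n⇒m≤1+n n<m)
    b = fromℕ< (ℕ.s≤s n<m)
    i≤pred-s : toℕ i ≤ ℕ.pred s
    i≤pred-s = ℕ.<⇒≤pred (Fin.toℕ<n i)
    n*q≤i : n ℕ.* q ≤ toℕ i
    n*q≤i = m/n*n≤m (toℕ i) q
    -- The clamp does not affect the lower end, which is at most `i`; only the upper end may be cut
    -- off.
    toℕ-a : toℕ (landmark a) ≡ n ℕ.* q
    toℕ-a = begin
      toℕ (landmark a)                ≡⟨ toℕ-landmark a ⟩
      (toℕ a ℕ.* q) ℕ.⊓ ℕ.pred s      ≡⟨ cong (λ c → (c ℕ.* q) ℕ.⊓ ℕ.pred s) (Fin.toℕ-fromℕ< (ℕ.m≤n⇒m≤1+n n<m)) ⟩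
      (n ℕ.* q) ℕ.⊓ ℕ.pred s          ≡⟨ ℕ.m≤n⇒m⊓n≡m (ℕ.≤-trans n*q≤i i≤pred-s) ⟩
      n ℕ.* q                         ∎
      where open ≡-Reasoning
    toℕ-b : toℕ (landmark b) ≡ (suc n ℕ.* q) ℕ.⊓ ℕ.pred s
    toℕ-b = trans (toℕ-landmark b) (cong (λ c → (c ℕ.* q) ℕ.⊓ ℕ.pred s) (Fin.toℕ-fromℕ< (ℕ.s≤s n<m)))
    a≤i : toℕ (landmark a) ≤ toℕ i
    a≤i = subst (_≤ toℕ i) (sym toℕ-a) n*q≤i
    i≤1+n*q : toℕ i ≤ suc n ℕ.* q
    i≤1+n*q = begin
      toℕ i                          ≡⟨ m≡m%n+[m/n]*n (toℕ i) q ⟩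
      toℕ i ℕ.% q ℕ.+ n ℕ.* q        ≤⟨ ℕ.+-monoˡ-≤ (n ℕ.* q) (ℕ.<⇒≤ (m%n<n (toℕ i) q)) ⟩
      q ℕ.+ n ℕ.* q                  ∎
      where open ℕ.≤-Reasoning
    i≤b : toℕ i ≤ toℕ (landmark b)
    i≤b = subst (toℕ i ≤_) (sym toℕ-b) (ℕ.⊓-glb i≤1+n*q i≤pred-s)
    b≤a+q : toℕ (landmark b) ≤ toℕ (landmark a) ℕ.+ q
    b≤a+q = begin
      toℕ (landmark b)                    ≡⟨ toℕ-b ⟩
      (suc n ℕ.* q) ℕ.⊓ ℕ.pred s          ≤⟨ ℕ.m⊓n≤m (suc n ℕ.* q) (ℕ.pred s) ⟩
      q ℕ.+ n ℕ.* q                       ≡⟨ ℕ.+-comm q (n ℕ.* q) ⟩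
      n ℕ.* q ℕ.+ q                       ≡⟨ cong (ℕ._+ q) toℕ-a ⟨
      toℕ (landmark a) ℕ.+ q              ∎
      where open ℕ.≤-Reasoning

-- What the corner argument asks of a distance, so that it serves `gridDist` and `truncDist k`
-- alike. Only `x` is assumed to be near `z`, because nothing is known about the position of `y`.
FaithfulUpTo : ∀ {s t} → ℕ → (Vtx s t → Vtx s t → ℕ) → Set
FaithfulUpTo c δ = ∀ x y z → gridDist x z ≤ c → δ x z ≡ δ y z → gridDist x z ≡ gridDist y z

gridDist-faithful : ∀ {s t} c → FaithfulUpTo {s} {t} c gridDist
gridDist-faithful c x y z _ eq = eq

-- The value at `x` stays below the cap `suc k`; an equal value at `y` is therefore not the cap but
-- the true distance.
truncDist-faithful : ∀ {s t} {c k} → c ≤ k → FaithfulUpTo {s} {t} c (truncDist k)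
truncDist-faithful {k = k} c≤k x y z d≤c eq = sym (trans (sym (ℕ.m≤n⇒m⊓n≡m (ℕ.<⇒≤ y<k+1))) (trans (sym eq) x⊓≡x))
  where
  d<k+1 : gridDist x z < suc k
  d<k+1 = ℕ.s≤s (ℕ.≤-trans d≤c c≤k)
  x⊓≡x : truncDist k x z ≡ gridDist x z
  x⊓≡x = ℕ.m≤n⇒m⊓n≡m (ℕ.<⇒≤ d<k+1)
  y<k+1 : gridDist y z < suc k
  y<k+1 = ℕ.≰⇒> λ k+1≤y → ℕ.<⇒≢ d<k+1
    (trans (sym x⊓≡x) (trans eq (ℕ.m≥n⇒m⊓n≡n k+1≤y)))

module _ {s t : ℕ} .{{_ : ℕ.NonZero s}} .{{_ : ℕ.NonZero t}} (m n q r : ℕ)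
  .{{_ : ℕ.NonZero q}} .{{_ : ℕ.NonZero r}} (s≤m*q : s ≤ m ℕ.* q) (t≤n*r : t ≤ n ℕ.* r)
  (δ : Vtx s t → Vtx s t → ℕ) (faithful : FaithfulUpTo (q ℕ.+ r) δ) where

  lattice-separates : ∀ x y → x ≢ y →
    ∃[ a ] ∃[ b ] δ x (landmark s m q a , landmark t n r b) ≢ δ y (landmark s m q a , landmark t n r b)
  lattice-separates x@(i , j) y@(u , v) x≢y =
    let a₀ , a₁ , a₀≤i , i≤a₁ , a₁≤a₀+q = bracket s m q s≤m*q i
        b₀ , b₁ , b₀≤j , j≤b₁ , b₁≤b₀+r = bracket t n r t≤n*r j
    in some-corner a₀ a₁ b₀ b₁ λ δ≡₀₀ δ≡₁₁ δ≡₀₁ →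
      -- Row distances to the corners are at most `q` and column distances at most `r`, so every
      -- corner lies within the faithful range `q + r`.
      let near-i = near a₀≤i i≤a₁ a₁≤a₀+q
          near-j = near b₀≤j j≤b₁ b₁≤b₀+r
      in x≢y (uncurry Vtx-≡ (three-corners a₀≤i i≤a₁ b₀≤j j≤b₁
        (faithful x y _ (ℕ.+-mono-≤ (proj₁ near-i) (proj₁ near-j)) δ≡₀₀)
        (faithful x y _ (ℕ.+-mono-≤ (proj₂ near-i) (proj₂ near-j)) δ≡₁₁)
        (faithful x y _ (ℕ.+-mono-≤ (proj₁ near-i) (proj₂ near-j)) δ≡₀₁)))
    where
    corner : Fin (suc m) → Fin (suc n) → Vtx s t
    corner a b = landmark s m q a , landmark t n r b

    -- Equality in ℕ is decidable, so refuting agreement at all three corners exhibits one where the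
    -- distances differ.
    some-corner : ∀ a₀ a₁ b₀ b₁ →
      (δ x (corner a₀ b₀) ≡ δ y (corner a₀ b₀) → δ x (corner a₁ b₁) ≡ δ y (corner a₁ b₁) →
       ¬ (δ x (corner a₀ b₁) ≡ δ y (corner a₀ b₁))) →
      ∃[ a ] ∃[ b ] δ x (corner a b) ≢ δ y (corner a b)
    some-corner a₀ a₁ b₀ b₁ not-all
      with δ x (corner a₀ b₀) ℕ.≟ δ y (corner a₀ b₀) | δ x (corner a₁ b₁) ℕ.≟ δ y (corner a₁ b₁)
    ... | no δ≢    | _        = a₀ , b₀ , δ≢
    ... | yes _    | no δ≢    = a₁ , b₁ , δ≢
    ... | yes δ≡₀₀ | yes δ≡₁₁ = a₀ , b₁ , not-all δ≡₀₀ δ≡₁₁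

    near : ∀ {lo hi c w} → lo ≤ c → c ≤ hi → hi ≤ lo ℕ.+ w → ∣ c - lo ∣ ≤ w × ∣ c - hi ∣ ≤ w
    near {lo} {hi} {c} {w} lo≤c c≤hi hi≤lo+w =
      ℕ.≤-trans (ℕ.m≤m+n (∣ c - lo ∣) (∣ c - hi ∣)) both , ℕ.≤-trans (ℕ.m≤n+m (∣ c - hi ∣) (∣ c - lo ∣)) both
      where
      both : ∣ c - lo ∣ ℕ.+ ∣ c - hi ∣ ≤ w
      both = ℕ.≤-trans (ℕ.≤-reflexive (distances-between lo≤c c≤hi)) (ℕ.m≤n+o⇒m∸n≤o hi lo hi≤lo+w)

  lattice-resolves : Σ (Vtx s t → ℚ) λ h → IsResolvingFn s t δ h × sumV s t h ≤ℚ ℕ→ℚ (suc m ℕ.* suc n)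
  lattice-resolves = landmarks-resolve δ (landmark s m q) (landmark t n r) lattice-separates

  minimum≤ : ∃[ r ] (IsMinWeight s t δ r × r ≤ℚ ℕ→ℚ (suc m ℕ.* suc n))
  minimum≤ =
    let h , resolving , Σ≤ = lattice-resolves
        r , r-min = minimum-exists δ resolving
    in r , r-min , ≤-trans (proj₂ r-min h resolving) Σ≤

-- Lower bounds from tilings

∣-∣> : ∀ {m n k} → m ℕ.+ suc k ≤ n → k < ∣ n - m ∣
∣-∣> {m} {n} {k} m+k<n = ℕ.≤-trans (ℕ.m+n≤o⇒m≤o∸n (suc k) (subst (_≤ n) (ℕ.+-comm m (suc k)) m+k<n)) (ℕ.m≤m+n _ _)

-- The hypotheses on `c` leave at least k positions of its block on either side, so any position in
-- another block is more than k steps away.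
other-tiles-far : ∀ {m w k} {I I′ : Fin m} {c i : Fin w} → I′ ≢ I → k ≤ toℕ c → toℕ c ℕ.+ suc k ≤ w →
  k < ∣ toℕ (combine I c) - toℕ (combine I′ i) ∣
other-tiles-far {m} {w} {k} {I} {I′} {c} {i} I′≢I k≤c c+k<w with Fin.<-cmp I′ I
... | tri≈ _ I′≡I _ = contradiction I′≡I I′≢I
... | tri< I′<I _ _ = ∣-∣> (begin
  toℕ (combine I′ i) ℕ.+ suc k             ≡⟨ ℕ.+-suc _ k ⟩
  suc (toℕ (combine I′ i)) ℕ.+ k           ≤⟨ ℕ.+-mono-≤ z<w*I k≤c ⟩
  w ℕ.* toℕ I ℕ.+ toℕ c                    ≡⟨ Fin.toℕ-combine I c ⟨
  toℕ (combine I c)                        ∎)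
  where
  open ℕ.≤-Reasoning
  z<w*I : toℕ (combine I′ i) < w ℕ.* toℕ I
  z<w*I = begin-strict
    toℕ (combine I′ i)                     ≡⟨ Fin.toℕ-combine I′ i ⟩
    w ℕ.* toℕ I′ ℕ.+ toℕ i                 <⟨ ℕ.+-monoʳ-< (w ℕ.* toℕ I′) (Fin.toℕ<n i) ⟩
    w ℕ.* toℕ I′ ℕ.+ w                     ≡⟨ trans (ℕ.+-comm _ w) (sym (ℕ.*-suc w (toℕ I′))) ⟩
    w ℕ.* suc (toℕ I′)                     ≤⟨ ℕ.*-monoʳ-≤ w I′<I ⟩
    w ℕ.* toℕ I                            ∎
... | tri> _ _ I<I′ = subst (k <_) (∣-∣-comm (toℕ (combine I′ i)) _) (∣-∣> (begin
  toℕ (combine I c) ℕ.+ suc k              ≡⟨ cong (ℕ._+ suc k) (Fin.toℕ-combine I c) ⟩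
  w ℕ.* toℕ I ℕ.+ toℕ c ℕ.+ suc k          ≡⟨ ℕ.+-assoc (w ℕ.* toℕ I) (toℕ c) (suc k) ⟩
  w ℕ.* toℕ I ℕ.+ (toℕ c ℕ.+ suc k)        ≤⟨ ℕ.+-monoʳ-≤ (w ℕ.* toℕ I) c+k<w ⟩
  w ℕ.* toℕ I ℕ.+ w                        ≡⟨ trans (ℕ.+-comm _ w) (sym (ℕ.*-suc w (toℕ I))) ⟩
  w ℕ.* suc (toℕ I)                        ≤⟨ ℕ.*-monoʳ-≤ w I<I′ ⟩
  w ℕ.* toℕ I′                             ≤⟨ ℕ.m≤m+n _ (toℕ i) ⟩
  w ℕ.* toℕ I′ ℕ.+ toℕ i                   ≡⟨ Fin.toℕ-combine I′ i ⟨
  toℕ (combine I′ i)                       ∎))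
  where open ℕ.≤-Reasoning

truncDist-far : ∀ {s t} k (x z : Vtx s t) → k < gridDist x z → truncDist k x z ≡ suc k
truncDist-far k x z = ℕ.m≥n⇒m⊓n≡n

module _ (k a b : ℕ) where
  private
    -- Reach k on both sides of two adjacent rows covers 2k+2 rows; around the one common column it
    -- covers 2k+1 columns.
    w = 2 ℕ.* k ℕ.+ 2
    l = 2 ℕ.* k ℕ.+ 1
    s = a ℕ.* w
    t = b ℕ.* l

    row : Fin a → Fin w → Fin s
    row = combine

    col : Fin b → Fin l → Fin t
    col = combine

  sum-tiles : ∀ (f : Vtx s t → ℚ) → sumV s t f ≡
    ∑[ I < a ] ∑[ i < w ] ∑[ J < b ] ∑[ j < l ] f (row I i , col J j)
  sum-tiles f = begin
    sumV s t f
      ≡⟨ sumV≡∑∑ f ⟩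
    ∑[ r < s ] ∑[ c < t ] f (r , c)
      ≡⟨ sum-combine a (λ r → ∑[ c < t ] f (r , c)) ⟩
    ∑[ I < a ] ∑[ i < w ] ∑[ c < t ] f (row I i , c)
      ≡⟨ sum-cong-≗ (λ I → sum-cong-≗ λ i → sum-combine b λ c → f (row I i , c)) ⟩
    ∑[ I < a ] ∑[ i < w ] ∑[ J < b ] ∑[ j < l ] f (row I i , col J j) ∎
    where open ≡-Reasoning

  tile-weight≥1 : ∀ g → IsResolvingFn s t (truncDist k) g → ∀ I J →
    1ℚ ≤ℚ ∑[ i < w ] ∑[ j < l ] g (row I i , col J j)
  tile-weight≥1 g (box , resolves) I J = begin
    1ℚ
      ≤⟨ resolves x y x≢y ⟩
    weightResolving s t (truncDist k) g x y
      ≡⟨ trans (weight≡ (truncDist k) g x y) (sum-tiles f) ⟩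
    ∑[ I′ < a ] ∑[ i < w ] ∑[ J′ < b ] ∑[ j < l ] f (row I′ i , col J′ j)
      -- In another row of tiles the row distance alone exceeds k. It has to be checked for both
      -- centres, as they lie in different rows.
      ≡⟨ sum-concentrated (λ I′ → ∑[ i < w ] ∑[ J′ < b ] ∑[ j < l ] f (row I′ i , col J′ j)) I
           (λ I′ I′≢I → sum-zero λ i → sum-zero λ J′ → sum-zero λ j → outside-rows (row I′ i , col J′ j)
             (other-tiles-far {I = I} {I′ = I′} {c = c₁} {i = i} I′≢I k≤c₁ c₁+k<w)
             (other-tiles-far {I = I} {I′ = I′} {c = c₂} {i = i} I′≢I k≤c₂ c₂+k<w)) ⟩
    ∑[ i < w ] ∑[ J′ < b ] ∑[ j < l ] f (row I i , col J′ j)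
      -- Both centres lie in column `c`, so a single column estimate settles both distances.
      ≡⟨ sum-cong-≗ (λ i → sum-concentrated (λ J′ → ∑[ j < l ] f (row I i , col J′ j)) J
           (λ J′ J′≢J → sum-zero λ j → outside-cols (row I i , col J′ j)
             (other-tiles-far {I = J} {I′ = J′} {c = c} {i = j} J′≢J k≤c c+k<l))) ⟩
    ∑[ i < w ] ∑[ j < l ] f (row I i , col J j)
      ≤⟨ sum-mono (λ i → sum-mono λ j → f≤g (row I i , col J j)) ⟩
    ∑[ i < w ] ∑[ j < l ] g (row I i , col J j) ∎
    where
    open ℚ.≤-Reasoning
    k+k+1≤l : k ℕ.+ suc k ≤ l
    k+k+1≤l = ℕ.≤-reflexive (eq k)
      where
      eq : ∀ k → k ℕ.+ suc k ≡ 2 ℕ.* k ℕ.+ 1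
      eq = solve-∀
    suck+k+1≤w : suc k ℕ.+ suc k ≤ w
    suck+k+1≤w = ℕ.≤-reflexive (eq k)
      where
      eq : ∀ k → suc k ℕ.+ suc k ≡ 2 ℕ.* k ℕ.+ 2
      eq = solve-∀
    k<l : k < l
    k<l = ℕ.m+n≤o⇒n≤o k k+k+1≤l
    k+1<w : suc k < w
    k+1<w = ℕ.<-≤-trans (ℕ.m<m+n (suc k) (ℕ.s≤s ℕ.z≤n)) suck+k+1≤w
    k<w : k < w
    k<w = ℕ.<-trans (ℕ.n<1+n k) k+1<w
    c₁ c₂ : Fin w
    -- The central rows are k and k+1, and the central column is k.
    c₁ = fromℕ< k<w
    c₂ = fromℕ< k+1<w
    c : Fin l
    c = fromℕ< k<l
    k≤c₁ : k ≤ toℕ c₁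
    k≤c₁ = ℕ.≤-reflexive (sym (Fin.toℕ-fromℕ< k<w))
    c₁+k<w : toℕ c₁ ℕ.+ suc k ≤ w
    c₁+k<w = subst (λ m → m ℕ.+ suc k ≤ w) (sym (Fin.toℕ-fromℕ< k<w)) (ℕ.≤-trans (ℕ.n≤1+n _) suck+k+1≤w)
    k≤c₂ : k ≤ toℕ c₂
    k≤c₂ = ℕ.≤-trans (ℕ.n≤1+n k) (ℕ.≤-reflexive (sym (Fin.toℕ-fromℕ< k+1<w)))
    c₂+k<w : toℕ c₂ ℕ.+ suc k ≤ w
    c₂+k<w = subst (λ m → m ℕ.+ suc k ≤ w) (sym (Fin.toℕ-fromℕ< k+1<w)) suck+k+1≤w
    k≤c : k ≤ toℕ c
    k≤c = ℕ.≤-reflexive (sym (Fin.toℕ-fromℕ< k<l))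
    c+k<l : toℕ c ℕ.+ suc k ≤ l
    c+k<l = subst (λ m → m ℕ.+ suc k ≤ l) (sym (Fin.toℕ-fromℕ< k<l)) k+k+1≤l
    x y : Vtx s t
    x = row I c₁ , col J c
    y = row I c₂ , col J c
    x≢y : x ≢ y
    x≢y x≡y = ℕ.<⇒≢ (ℕ.n<1+n k) (trans (sym (Fin.toℕ-fromℕ< k<w)) (trans
      (cong toℕ (Fin.combine-injectiveʳ I c₁ I c₂ (cong proj₁ x≡y))) (Fin.toℕ-fromℕ< k+1<w)))
    f : Vtx s t → ℚ
    f z = separation (truncDist k) x y z * g z
    outside : ∀ z → k < gridDist x z → k < gridDist y z → f z ≡ 0ℚ
    outside z k<x k<y = trans (cong (_* g z) (unseparated (truncDist k) x y z
      (trans (truncDist-far k x z k<x) (sym (truncDist-far k y z k<y))))) (*-zeroˡ (g z))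
    outside-rows : ∀ z → k < ∣ toℕ (proj₁ x) - toℕ (proj₁ z) ∣ → k < ∣ toℕ (proj₁ y) - toℕ (proj₁ z) ∣ → f z ≡ 0ℚ
    outside-rows z k<x k<y = outside z
      (ℕ.<-≤-trans k<x (ℕ.m≤m+n _ (∣ toℕ (proj₂ x) - toℕ (proj₂ z) ∣)))
      (ℕ.<-≤-trans k<y (ℕ.m≤m+n _ (∣ toℕ (proj₂ y) - toℕ (proj₂ z) ∣)))
    outside-cols : ∀ z → k < ∣ toℕ (col J c) - toℕ (proj₂ z) ∣ → f z ≡ 0ℚ
    outside-cols z k<c = outside z
      (ℕ.<-≤-trans k<c (ℕ.m≤n+m _ (∣ toℕ (proj₁ x) - toℕ (proj₁ z) ∣)))
      (ℕ.<-≤-trans k<c (ℕ.m≤n+m _ (∣ toℕ (proj₁ y) - toℕ (proj₁ z) ∣)))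
    f≤g : ∀ z → f z ≤ℚ g z
    f≤g z = masked (truncDist k x z ℕ.≟ truncDist k y z)
      where
      masked : ∀ {P : Set} (d : Dec P) → unless d * g z ≤ℚ g z
      masked (yes _) = subst (_≤ℚ g z) (sym (*-zeroˡ (g z))) (proj₁ (box z))
      masked (no _)  = ≤-reflexive (*-identityˡ (g z))

  tiles≤weight : ∀ g → IsResolvingFn s t (truncDist k) g → ℕ→ℚ (a ℕ.* b) ≤ℚ sumV s t g
  tiles≤weight g resolving = begin
    ℕ→ℚ (a ℕ.* b)                      ≡⟨ ℕ→ℚ-* a b ⟩
    ℕ→ℚ a * ℕ→ℚ b                      ≡⟨ cong (ℕ→ℚ a *_) (trans (sum-const b 1ℚ) (*-identityʳ (ℕ→ℚ b))) ⟨
    ℕ→ℚ a * ∑[ J < b ] 1ℚ              ≡⟨ sum-const a (∑[ J < b ] 1ℚ) ⟨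
    ∑[ I < a ] ∑[ J < b ] 1ℚ           ≤⟨ sum-mono (λ I → sum-mono λ J → tile-weight≥1 g resolving I J) ⟩
    ∑[ I < a ] ∑[ J < b ] ∑[ i < w ] ∑[ j < l ] g (row I i , col J j)
      -- The estimate runs tile by tile, whereas `sum-tiles` finishes a row of tiles before its
      -- columns.
      ≡⟨ sum-cong-≗ (λ I → ∑-comm {b} {w} λ J i → ∑[ j < l ] g (row I i , col J j)) ⟩
    ∑[ I < a ] ∑[ i < w ] ∑[ J < b ] ∑[ j < l ] g (row I i , col J j)
      ≡⟨ sum-tiles g ⟨
    sumV s t g                         ∎
    where open ℚ.≤-Reasoning

  tiles≤dimension : ∀ {r} → IsTruncFracDim k s t r → ℕ→ℚ (a ℕ.* b) ≤ℚ r
  tiles≤dimension ((g , resolving , Σ≡r) , _) = subst (ℕ→ℚ (a ℕ.* b) ≤ℚ_) Σ≡r (tiles≤weight g resolving)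

-- The grids G_k

minimum-nonneg : ∀ s t (δ : Vtx s t → Vtx s t → ℕ) {r} → IsMinWeight s t δ r → 0ℚ ≤ℚ r
minimum-nonneg s t δ ((g , (box , _) , Σ≡r) , _) = subst (0ℚ ≤ℚ_) (trans (sym (sumV≡∑∑ g)) Σ≡r)
  (sum-nonneg λ i → sum-nonneg λ j → proj₁ (box (i , j)))

truncDist-separates : ∀ k {s t} (x y : Vtx s t) → x ≢ y → truncDist k x x ≢ truncDist k y x
truncDist-separates k x@(i , j) y x≢y δ≡ = x≢y (uncurry Vtx-≡
  -- The box shrinks to the single point `x`, so all three corner equations are the one equation
  -- `d≡`.
  (three-corners {i = toℕ i} {j = toℕ j} ℕ.≤-refl ℕ.≤-refl ℕ.≤-refl ℕ.≤-refl d≡ d≡ d≡))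
  where
  ∣n-n∣≡0 : ∀ n → ∣ n - n ∣ ≡ 0
  ∣n-n∣≡0 n = trans (∣-∣≡ n n) (ℕ.∣n-n∣≡0 n)
  d≡ : gridDist x x ≡ gridDist y x
  d≡ = truncDist-faithful {c = 0} {k = k} ℕ.z≤n x y x
    (ℕ.≤-reflexive (cong₂ ℕ._+_ (∣n-n∣≡0 (toℕ i)) (∣n-n∣≡0 (toℕ j)))) δ≡

-- With every vertex as a landmark the constant weight 1 resolves. This also covers k = 1, where no
-- positive spacing satisfies 2q ≤ k.
truncFracDim-exists : ∀ k s t → ∃[ r ] IsTruncFracDim k s t r
truncFracDim-exists k s t =
  let h , resolving , _ = landmarks-resolve (truncDist k) id id λ x y x≢y →
        proj₁ x , proj₂ x , truncDist-separates k x y x≢y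
  in minimum-exists (truncDist k) resolving

sG-nonZero : ∀ k → ℕ.NonZero (sG k)
sG-nonZero k = ℕ.m*n≢0 (2 ℕ.* k ℕ.+ 2) (2 ℕ.* k ℕ.+ 2) {{nz}} {{nz}}
  where nz = ℕ.>-nonZero (ℕ.≤-trans (ℕ.s≤s ℕ.z≤n) (ℕ.m≤n+m 2 (2 ℕ.* k)))

tG-nonZero : ∀ k → ℕ.NonZero (tG k)
tG-nonZero k = ℕ.m*n≢0 (2 ℕ.* k ℕ.+ 1) (2 ℕ.* k ℕ.+ 1) {{nz}} {{nz}}
  where nz = ℕ.>-nonZero (ℕ.m≤n+m 1 (2 ℕ.* k))

module _ (k : ℕ) (1<k : 1 < k) where
  private
    -- This spacing keeps the cell corners within distance 2q ≤ k and is positive because k > 1.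
    -- Since 2k+2 ≤ 8q, 8(2k+2) intervals cover each side.
    q = k / 2
    n = (2 ℕ.* k ℕ.+ 2) ℕ.* 8

    0<q : 0 < q
    0<q = m≥n⇒m/n>0 1<k

    -- From k ≤ 2q+1 follows 2k+2 ≤ 4q+4, and q ≥ 1 absorbs the 4.
    2k+2≤8q : 2 ℕ.* k ℕ.+ 2 ≤ 8 ℕ.* q
    2k+2≤8q = begin
      2 ℕ.* k ℕ.+ 2                          ≡⟨ cong (λ c → 2 ℕ.* c ℕ.+ 2) (m≡m%n+[m/n]*n k 2) ⟩
      2 ℕ.* (k ℕ.% 2 ℕ.+ q ℕ.* 2) ℕ.+ 2      ≤⟨ ℕ.+-monoˡ-≤ 2 (ℕ.*-monoʳ-≤ 2 (ℕ.+-monoˡ-≤ (q ℕ.* 2) (ℕ.<⇒≤pred (m%n<n k 2)))) ⟩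
      2 ℕ.* (1 ℕ.+ q ℕ.* 2) ℕ.+ 2            ≡⟨ expand q ⟩
      4 ℕ.* 1 ℕ.+ 4 ℕ.* q                    ≤⟨ ℕ.+-monoˡ-≤ (4 ℕ.* q) (ℕ.*-monoʳ-≤ 4 0<q) ⟩
      4 ℕ.* q ℕ.+ 4 ℕ.* q                    ≡⟨ ℕ.*-distribʳ-+ q 4 4 ⟨
      8 ℕ.* q                                ∎
      where
      open ℕ.≤-Reasoning
      expand : ∀ q → 2 ℕ.* (1 ℕ.+ q ℕ.* 2) ℕ.+ 2 ≡ 4 ℕ.* 1 ℕ.+ 4 ℕ.* q
      expand = solve-∀

    sG≤n*q : sG k ≤ n ℕ.* q
    sG≤n*q = ℕ.≤-trans (ℕ.*-monoʳ-≤ (2 ℕ.* k ℕ.+ 2) 2k+2≤8q) (ℕ.≤-reflexive (sym (ℕ.*-assoc (2 ℕ.* k ℕ.+ 2) 8 q)))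

    tG≤n*q : tG k ≤ n ℕ.* q
    tG≤n*q = ℕ.≤-trans (ℕ.*-mono-≤ 2k+1≤2k+2 2k+1≤2k+2) sG≤n*q
      where
      2k+1≤2k+2 : 2 ℕ.* k ℕ.+ 1 ≤ 2 ℕ.* k ℕ.+ 2
      2k+1≤2k+2 = ℕ.+-monoʳ-≤ (2 ℕ.* k) (ℕ.s≤s ℕ.z≤n)

    -- The origin of the constant 33: there are 16k+17 landmarks per side, and 17 ≤ 17k.
    1+n≤33k : suc n ≤ 33 ℕ.* k
    1+n≤33k = begin
      suc n                          ≡⟨ expand k ⟩
      16 ℕ.* k ℕ.+ 17 ℕ.* 1          ≤⟨ ℕ.+-monoʳ-≤ (16 ℕ.* k) (ℕ.*-monoʳ-≤ 17 (ℕ.<⇒≤ 1<k)) ⟩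
      16 ℕ.* k ℕ.+ 17 ℕ.* k          ≡⟨ ℕ.*-distribʳ-+ k 16 17 ⟨
      33 ℕ.* k                       ∎
      where
      open ℕ.≤-Reasoning
      expand : ∀ k → suc ((2 ℕ.* k ℕ.+ 2) ℕ.* 8) ≡ 16 ℕ.* k ℕ.+ 17 ℕ.* 1
      expand = solve-∀

    q+q≤k : q ℕ.+ q ≤ k
    q+q≤k = ℕ.≤-trans (ℕ.≤-reflexive (double q)) (m/n*n≤m k 2)
      where
      double : ∀ q → q ℕ.+ q ≡ q ℕ.* 2
      double = solve-∀

  truncFracDim-G≤ : ∃[ r ] (IsTruncFracDim k (sG k) (tG k) r × r ≤ℚ ℕ→ℚ (33 ℕ.* 33 ℕ.* (k ℕ.* k)))
  truncFracDim-G≤ =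
    let r , r-min , r≤ = minimum≤ n n q q sG≤n*q tG≤n*q (truncDist k) (truncDist-faithful q+q≤k)
    in r , r-min , ≤-trans r≤ (ℕ→ℚ-mono-≤ (ℕ.≤-trans (ℕ.*-mono-≤ 1+n≤33k 1+n≤33k)
         (ℕ.≤-reflexive (ℕ.[m*n]*[o*p]≡[m*o]*[n*p] 33 k 33 k))))
    where instance
      _ = ℕ.>-nonZero 0<q
      _ = sG-nonZero k
      _ = tG-nonZero k

-- A single cell spans the whole grid, which gives 2 · 2 landmarks; the exact distance is faithful
-- at any range.
fracDim-G≤4 : ∀ k → ∃[ r ] (IsFracDim (sG k) (tG k) r × r ≤ℚ ℕ→ℚ 4)
fracDim-G≤4 k = minimum≤ 1 1 (sG k) (tG k) (ℕ.≤-reflexive (sym (ℕ.*-identityˡ (sG k))))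
  (ℕ.≤-reflexive (sym (ℕ.*-identityˡ (tG k)))) gridDist (gridDist-faithful (sG k ℕ.+ tG k))
  where instance
    _ = sG-nonZero k
    _ = tG-nonZero k

k≤tiles : ∀ k → k ℕ.* k ≤ (2 ℕ.* k ℕ.+ 2) ℕ.* (2 ℕ.* k ℕ.+ 1)
k≤tiles k = ℕ.*-mono-≤ (k≤ 2) (k≤ 1)
  where
  k≤ : ∀ c → k ≤ 2 ℕ.* k ℕ.+ c
  k≤ c = ℕ.≤-trans (ℕ.m≤n*m k 2) (ℕ.m≤m+n (2 ℕ.* k) c)

-- The side lengths enter through equations because the sides of `G_k` are multiples of 4 and 3 only
-- up to a ring identity.
truncFracDim-tiled≥ : ∀ k a b {s t r} → s ≡ a ℕ.* (2 ℕ.* k ℕ.+ 2) → t ≡ b ℕ.* (2 ℕ.* k ℕ.+ 1) →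
  IsTruncFracDim k s t r → ℕ→ℚ (a ℕ.* b) ≤ℚ r
truncFracDim-tiled≥ k a b refl refl = tiles≤dimension k a b

-- `M` may be negative, so it is first replaced by a natural upper bound `N`; multiplying then uses
-- only nonnegative factors.
scaled< : ∀ N c d {M r r′} → M ≤ℚ ℕ→ℚ N → 0ℚ ≤ℚ r → r ≤ℚ ℕ→ℚ c → N ℕ.* c < d → ℕ→ℚ d ≤ℚ r′ → M * r <ℚ r′
scaled< N c d {M} {r} {r′} M≤N 0≤r r≤c Nc<d d≤r′ = begin-strict
  M * r                ≤⟨ *-mono-≤ (0≤ℕ→ℚ N) 0≤r M≤N r≤c ⟩
  ℕ→ℚ N * ℕ→ℚ c        ≡⟨ ℕ→ℚ-* N c ⟨
  ℕ→ℚ (N ℕ.* c)        <⟨ ℕ→ℚ-mono-< Nc<d ⟩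
  ℕ→ℚ d                ≤⟨ d≤r′ ⟩
  r′                   ∎
  where open ℚ.≤-Reasoning

truncFracDim-G-Θ : ∀ k → 1 < k → ∃[ r ] (IsTruncFracDim k (sG k) (tG k) r
  × (1ℚ * ℕ→ℚ (k ℕ.* k) ≤ℚ r) × (r ≤ℚ ℕ→ℚ (33 ℕ.* 33) * ℕ→ℚ (k ℕ.* k)))
truncFracDim-G-Θ k 1<k =
  let r , r-min , r≤ = truncFracDim-G≤ k 1<k
  in r , r-min
   , subst (_≤ℚ r) (sym (*-identityˡ (ℕ→ℚ (k ℕ.* k)))) (≤-trans (ℕ→ℚ-mono-≤ (k≤tiles k))
       (tiles≤dimension k (2 ℕ.* k ℕ.+ 2) (2 ℕ.* k ℕ.+ 1) r-min))
   , subst (r ≤ℚ_) (ℕ→ℚ-* (33 ℕ.* 33) (k ℕ.* k)) r≤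

-- For k ≡ 1 mod 3 the 4 × 3 tiles of the case k = 1 fit G_k exactly.
module _ (m : ℕ) where
  private
    k = 3 ℕ.* m ℕ.+ 1
    a = suc k ℕ.* suc k
    -- Here 2k+1 = 3(2m+1), so one factor 3 of (2k+1)² is the tile width and the rest counts the
    -- tiles. In the rows (2k+2)² = 4(k+1)².
    b = 3 ℕ.* (suc (2 ℕ.* m) ℕ.* suc (2 ℕ.* m))

  dim₁-G≥ : ∀ {r} → IsTruncFracDim 1 (sG k) (tG k) r → ℕ→ℚ (a ℕ.* b) ≤ℚ r
  dim₁-G≥ = truncFracDim-tiled≥ 1 a b (rows m) (cols m)
    where
    rows : ∀ m → (2 ℕ.* (3 ℕ.* m ℕ.+ 1) ℕ.+ 2) ℕ.* (2 ℕ.* (3 ℕ.* m ℕ.+ 1) ℕ.+ 2)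
               ≡ suc (3 ℕ.* m ℕ.+ 1) ℕ.* suc (3 ℕ.* m ℕ.+ 1) ℕ.* 4
    rows = solve-∀
    cols : ∀ m → (2 ℕ.* (3 ℕ.* m ℕ.+ 1) ℕ.+ 1) ℕ.* (2 ℕ.* (3 ℕ.* m ℕ.+ 1) ℕ.+ 1)
               ≡ 3 ℕ.* (suc (2 ℕ.* m) ℕ.* suc (2 ℕ.* m)) ℕ.* 3
    cols = solve-∀

  -- The factor `a` = (k+1)² absorbs k², and the crude bound m ≤ `b` leaves room for the constant
  -- `N * c`.
  dim₁-exceeds : ∀ N c → N ℕ.* c < m → N ℕ.* (c ℕ.* (k ℕ.* k)) < a ℕ.* b
  dim₁-exceeds N c Nc<m = begin-strict
    N ℕ.* (c ℕ.* (k ℕ.* k))        ≡⟨ trans (sym (ℕ.*-assoc N c (k ℕ.* k))) (ℕ.*-comm (N ℕ.* c) (k ℕ.* k)) ⟩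
    k ℕ.* k ℕ.* (N ℕ.* c)          ≤⟨ ℕ.*-monoˡ-≤ (N ℕ.* c) (ℕ.*-mono-≤ (ℕ.n≤1+n k) (ℕ.n≤1+n k)) ⟩
    a ℕ.* (N ℕ.* c)                <⟨ ℕ.*-monoʳ-< a (ℕ.<-≤-trans Nc<m m≤b) ⟩
    a ℕ.* b                        ∎
    where
    open ℕ.≤-Reasoning
    m≤b : m ≤ b
    m≤b = begin
      m                                           ≤⟨ ℕ.m≤n*m m 2 ⟩
      2 ℕ.* m                                     ≤⟨ ℕ.n≤1+n (2 ℕ.* m) ⟩
      suc (2 ℕ.* m)                               ≤⟨ ℕ.m≤m*n (suc (2 ℕ.* m)) (suc (2 ℕ.* m)) ⟩
      suc (2 ℕ.* m) ℕ.* suc (2 ℕ.* m)             ≤⟨ ℕ.m≤n*m (suc (2 ℕ.* m) ℕ.* suc (2 ℕ.* m)) 3 ⟩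
      b                                           ∎

dim₁/dimₖ-unbounded : ∀ (M : ℚ) → ∃[ k ] (1 < k × ∃[ r₁ ] ∃[ rₖ ]
  (IsTruncFracDim 1 (sG k) (tG k) r₁ × IsTruncFracDim k (sG k) (tG k) rₖ × (M * rₖ <ℚ r₁)))
dim₁/dimₖ-unbounded M =
  let N , M≤N            = ≤ℕ→ℚ M
      -- The least `m` with `N` · 33² < `m`, as `dim₁-exceeds` requires.
      m                  = suc (N ℕ.* (33 ℕ.* 33))
      k                  = 3 ℕ.* m ℕ.+ 1
      1<k                = ℕ.+-monoˡ-≤ 1 (ℕ.≤-trans (ℕ.s≤s ℕ.z≤n) (ℕ.m≤n*m m 3))
      r₁ , r₁-min        = truncFracDim-exists 1 (sG k) (tG k)
      rₖ , rₖ-min , rₖ≤  = truncFracDim-G≤ k 1<k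
  in k , 1<k , r₁ , rₖ , r₁-min , rₖ-min
   , scaled< N (33 ℕ.* 33 ℕ.* (k ℕ.* k)) (suc k ℕ.* suc k ℕ.* (3 ℕ.* (suc (2 ℕ.* m) ℕ.* suc (2 ℕ.* m))))
       M≤N (minimum-nonneg (sG k) (tG k) (truncDist k) rₖ-min) rₖ≤
       (dim₁-exceeds m N (33 ℕ.* 33) ℕ.≤-refl) (dim₁-G≥ m r₁-min)

dimₖ/dim-unbounded : ∀ (M : ℚ) → ∃[ k ] (1 < k × ∃[ rₖ ] ∃[ r ]
  (IsTruncFracDim k (sG k) (tG k) rₖ × IsFracDim (sG k) (tG k) r × (M * r <ℚ rₖ)))
dimₖ/dim-unbounded M =
  let N , M≤N      = ≤ℕ→ℚ M
      -- The summand 2 ensures 1 < k, and 4N < k ≤ k² puts the number of tiles above `N` times the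
      -- bound 4.
      k            = 2 ℕ.+ N ℕ.* 4
      rₖ , rₖ-min  = truncFracDim-exists k (sG k) (tG k)
      r , r-min , r≤4 = fracDim-G≤4 k
  in k , ℕ.s≤s (ℕ.s≤s ℕ.z≤n) , rₖ , r , rₖ-min , r-min
   , scaled< N 4 ((2 ℕ.* k ℕ.+ 2) ℕ.* (2 ℕ.* k ℕ.+ 1)) M≤N (minimum-nonneg (sG k) (tG k) gridDist r-min) r≤4
       (ℕ.<-≤-trans (ℕ.m<n+m (N ℕ.* 4) {2} (ℕ.s≤s ℕ.z≤n)) (ℕ.≤-trans (ℕ.m≤m*n k k) (k≤tiles k)))
       (tiles≤dimension k (2 ℕ.* k ℕ.+ 2) (2 ℕ.* k ℕ.+ 1) rₖ-min)

theorem3p9 : (Σ ℚ λ c₁ → Σ ℚ λ c₂ → Σ ℕ λ K →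
    (0ℚ <ℚ c₁) × (0ℚ <ℚ c₂) ×
    (∀ k → 1 < k → K ≤ k →
    ∃[ r ] (IsTruncFracDim k (sG k) (tG k) r
    × (c₁ * ℕ→ℚ (k ℕ.* k) ≤ℚ r) × (r ≤ℚ c₂ * ℕ→ℚ (k ℕ.* k)))))
    ×
    (∀ (M : ℚ) → ∃[ k ] (1 < k × ∃[ r₁ ] ∃[ rₖ ]
    (IsTruncFracDim 1 (sG k) (tG k) r₁ × IsTruncFracDim k (sG k) (tG k) rₖ
    × (M * rₖ <ℚ r₁))))
    ×
    (∀ (M : ℚ) → ∃[ k ] (1 < k × ∃[ rₖ ] ∃[ r ]
    (IsTruncFracDim k (sG k) (tG k) rₖ × IsFracDim (sG k) (tG k) r
    × (M * r <ℚ rₖ))))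
theorem3p9 =
    -- Both bounds hold for every k > 1, so the threshold is 0.
    (1ℚ , ℕ→ℚ (33 ℕ.* 33) , 0 , ℕ→ℚ-mono-< {0} {1} (ℕ.s≤s ℕ.z≤n) , ℕ→ℚ-mono-< {0} {33 ℕ.* 33} (ℕ.s≤s ℕ.z≤n)
      , λ k 1<k _ → truncFracDim-G-Θ k 1<k)
  , dim₁/dimₖ-unbounded
  , dimₖ/dim-unbounded
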